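{- If $\Lambda\subseteq\mathbb{Z}^n$ is an integer lattice (a lattice of rank $n$ with a generator matrix having integer entries) which is a tiling with $\Upsilon_n$, then either $n=2^t-1$ or $n=3^t-1$ for some $t>0$.
   Context: $\Upsilon_n=\{U\in\mathbb{Z}^n:\sum_i|x_i-u_i|\le1\text{ for some }X\in\{ -1,0\}^n\}$. A set $T\subseteq\mathbb{Z}^n$ is a tiling with $\Upsilon_n$ if the translates $X+\Upsilon_n$, $X\in T$, partition $\mathbb{Z}^n$. -}

module Defs where

open import Data.Nat using (ℕ; _≤_)
open import Data.Integer using (ℤ; _-_; _+_; _*_; ∣_∣; -1ℤ; 0ℤ)
open import Data.Vec using (Vec; zipWith; map; foldr; replicate)
open import Data.Vec.Relation.Unary.All using (All)
open import Data.Product using (Σ; ∃; _×_)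
open import Data.Sum using (_⊎_)
open import Relation.Binary.PropositionalEquality using (_≡_)

Point : ℕ → Set
Point n = Vec ℤ n

dist₁ : ∀ {n} → Point n → Point n → ℕ
dist₁ x u = Data.Vec.sum (zipWith (λ a b → ∣ a - b ∣) x u)

InCube : ∀ {n} → Point n → Set
InCube x = All (λ a → a ≡ -1ℤ ⊎ a ≡ 0ℤ) x

Upsilon : ∀ n → Point n → Set
Upsilon n u = ∃ λ (x : Point n) → InCube x × dist₁ x u ≤ 1

_⊕_ : ∀ {n} → Point n → Point n → Point n
x ⊕ y = zipWith _+_ x y

IsTiling : ∀ n → (Point n → Set) → Set
IsTiling n T =
  (∀ (z : Point n) → ∃ λ x → ∃ λ u → T x × Upsilon n u × z ≡ x ⊕ u)
  × (∀ (x x′ u u′ : Point n) → T x → T x′ → Upsilon n u → Upsilon n u′ →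
       x ⊕ u ≡ x′ ⊕ u′ → x ≡ x′)

Matrix : ℕ → Set
Matrix n = Vec (Vec ℤ n) n

dot : ∀ {n} → Vec ℤ n → Vec ℤ n → ℤ
dot r k = foldr _ _+_ 0ℤ (zipWith _*_ r k)

_·_ : ∀ {n} → Matrix n → Point n → Point n
G · k = map (λ r → dot r k) G

-- G has rank n: its columns are linearly independent over ℤ
-- (equivalently over ℚ): G k = 0 implies k = 0.
FullRank : ∀ {n} → Matrix n → Set
FullRank {n} G = ∀ (k : Point n) → G · k ≡ replicate n 0ℤ → k ≡ replicate n 0ℤ

LatticeOf : ∀ {n} → Matrix n → Point n → Set
LatticeOf G x = ∃ λ k → x ≡ G · k

{-# OPTIONS --safe #-}
{-
For f : ℤⁿ → ℕ put (P f)(z) = Σ f(z + c) over c ∈ {−1,0}ⁿ and (S f)(z) = Σᵢ f(z + eᵢ) + f(z − eᵢ).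
Since x + x⁻² = (1 + x⁻¹)(x − 1 + x⁻¹), summing f over z + Υₙ gives P f + (P S f − n P f), so with δ
the indicator function of Λ the tiling condition reads P S δ = (n − 1) P δ + 1.

Let p be an odd prime dividing n + 1 and choose a power q = p^L with q (q − 1) eᵢ ∈ Λ for all i.
Let H = {z : (q − 1) z ∈ Λ} and let k be the number of i with eᵢ ∈ H.

The indicator function η of H is a sum of translates of δ, so P (S η − (n − 1) η) is a positive
constant. As η has the odd period q in every direction, P can be inverted one coordinate at a time,
and S η − (n − 1) η is itself a positive constant. At the origin this gives n ≤ 2k.

Modulo p the operator Q = 2 + S satisfies P Q δ = 1 and Q 1 = 2(n + 1) = 0, whence P Q^q δ = 0, and by
Frobenius Q^q = 2 + Σᵢ (shifts by ± q eᵢ). Where eᵢ ∈ H, shifting δ by ± q eᵢ is the same as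
shifting by ± eᵢ, so the arms in these k directions occur in P Q^q δ; each of their cells is covered
there a multiple of p times, hence at least p − 1 times by the other n − k directions. Counting
over one tile gives (p − 1) k ≤ 2 (n − k).

Together these force p = 3 and n = 2k. Hence n + 1 is a power of 2 or a power of 3.
-}

module Submission where

open import Defs
open import Algebra.Bundles using (Semiring; CommutativeMonoid)
import Algebra.Properties.Semiring.Mult as Mult
open import Data.Fin using (Fin; zero; suc; toℕ; inject₁; fromℕ; funToFin; finToFun)
open import Data.Fin.Properties using (toℕ<n; toℕ-inject₁; toℕ-fromℕ; pigeonhole; finToFun-funToFin)
open import Data.Integer as ℤ using (ℤ; +_; -[1+_]; 0ℤ; 1ℤ; -1ℤ)
import Data.Integer.Properties as ℤₚ
import Data.Integer.Tactic.RingSolver as ℤ-Solver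
open import Data.List as List using (List; []; _∷_; _++_; length; map; allFin)
import Data.List.Properties as Listₚ
open import Data.List.Membership.Propositional using (_∈_)
open import Data.List.Membership.Propositional.Properties
  using (∈-++⁺ˡ; ∈-++⁺ʳ; ∈-map⁺; ∈-++⁻; ∈-map⁻; ∈-length)
open import Data.List.Relation.Binary.Disjoint.Propositional using (Disjoint)
open import Data.List.Relation.Unary.All as All using (All; []; _∷_)
open import Data.List.Relation.Unary.AllPairs using ([]; _∷_)
open import Data.List.Relation.Unary.Any using (here; there; index)
open import Data.List.Relation.Unary.Any.Properties using (lookup-index)
open import Data.List.Relation.Unary.Unique.Propositional using (Unique)
import Data.List.Relation.Unary.Unique.Propositional.Properties as Uniqueₚ
open import Data.Nat as ℕ
  using (ℕ; zero; suc; z≤n; s≤s; _+_; _*_; _^_; _∸_; _%_; _!; _≤_; _<_)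
open import Data.Nat.Combinatorics using (_C_; nCn≡1; nCk≡n!/k![n-k]!; k![n∸k]!∣n!)
open import Data.Nat.Divisibility
  using (_∣_; divides; _∣?_; ∣⇒≤; ∣1⇒≡1; m∣m*n; ∣m⇒∣m*n; ∣m+n∣m⇒∣n; m%n≡0⇒n∣m)
open import Data.Nat.DivMod using (m/n*n≡m; %-distribˡ-+; m*n%n≡0; [m+kn]%n≡m%n)
open import Data.Nat.ListAction using (sum; product)
open import Data.Nat.ListAction.Properties using (sum-++; ∈⇒∣product)
open import Data.Nat.Primality
  using (Prime; prime?; euclidsLemma; ¬prime[0]; ¬prime[1];
         prime⇒nonZero; prime⇒nonTrivial; prime⇒irreducible)
open import Data.Nat.Primality.Factorisation using (factorise)
import Data.Nat.Properties as ℕₚ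
open import Algebra.Properties.CommutativeSemigroup ℕₚ.+-commutativeSemigroup using (interchange)
open import Data.Nat.Tactic.RingSolver using (solve-∀)
open import Data.Product using (∃; _×_; _,_; proj₁; proj₂; map₂)
open import Data.Sum using (_⊎_; inj₁; inj₂)
open import Data.Vec as Vec using (Vec; []; _∷_; replicate)
import Data.Vec.Properties as Vecₚ
open import Data.Vec.Relation.Unary.All using ([]; _∷_)
open import Function using (_∘_)
open import Relation.Binary.PropositionalEquality
  using (_≡_; _≢_; refl; sym; trans; cong; cong₂; subst; subst₂; module ≡-Reasoning)
open import Relation.Nullary using (contradiction; ¬_; Dec; yes; no)
open import Relation.Nullary.Decidable using (from-yes)
open import Relation.Unary using (Pred; Decidable)

private variable
  I J : Set
  n : ℕ

-- Frobenius in characteristic p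

prime∤! : ∀ {p} → Prime p → ∀ {m} → m < p → ¬ p ∣ m !
prime∤! pr {zero} _ d = contradiction (∣1⇒≡1 d) λ { refl → ¬prime[1] pr }
prime∤! pr {suc m} m<p d with euclidsLemma (suc m) (m !) pr d
... | inj₁ e = ℕₚ.<⇒≱ m<p (∣⇒≤ e)
... | inj₂ e = prime∤! pr (ℕₚ.<-trans (ℕₚ.n<1+n m) m<p) e

-- p divides p! = C(p,k) k! (p - k)!, and neither factorial has the factor p, because k and p - k
-- are both below p.
p∣pCk : ∀ {p} → Prime p → ∀ {k} → 0 < k → k < p → p ∣ p C k
p∣pCk {suc p} pr {k} 0<k k<p
  with euclidsLemma (suc p C k) (k ! * (suc p ∸ k) !) pr (subst (suc p ∣_) (sym eq) (m∣m*n (p !)))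
  where
  instance _ = ℕₚ._!*_!≢0 k (suc p ∸ k)
  eq : (suc p C k) * (k ! * (suc p ∸ k) !) ≡ suc p !
  eq = trans (cong (_* (k ! * (suc p ∸ k) !)) (nCk≡n!/k![n-k]! (ℕₚ.<⇒≤ k<p)))
    (m/n*n≡m (k![n∸k]!∣n! (ℕₚ.<⇒≤ k<p)))
... | inj₁ d = d
... | inj₂ d with euclidsLemma (k !) ((suc p ∸ k) !) pr d
...   | inj₁ e = contradiction e (prime∤! pr k<p)
...   | inj₂ e = contradiction e (prime∤! pr (ℕₚ.∸-monoʳ-< 0<k (ℕₚ.<⇒≤ k<p)))

module Frobenius {a ℓ} (R : Semiring a ℓ) where
  open Semiring R hiding (zero; sym; refl) renaming (_+_ to _⊞_; _*_ to _⊠_; trans to ≈-trans)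
  open Mult R using (×-assocˡ; ×-homo-1; ×-congˡ) renaming (_×_ to _·×_)
  open import Algebra.Properties.Semiring.Exp R public renaming (_^_ to _↑_)
  open import Algebra.Properties.Semiring.Sum R
    using (sum-init-last; sum-cong-≋; sum-replicate-zero) renaming (sum to ∑ᶠ)
  import Algebra.Properties.Semiring.Binomial R as B
  open import Relation.Binary.Reasoning.Setoid setoid

  ∣⇒×≈0 : ∀ {p m} → (∀ x → p ·× x ≈ 0#) → p ∣ m → ∀ x → m ·× x ≈ 0#
  ∣⇒×≈0 {p} char (divides q refl) x = begin
    (q * p) ·× x  ≈⟨ ×-congˡ (ℕₚ.*-comm q p) ⟩
    (p * q) ·× x  ≈⟨ ×-assocˡ x p q ⟨
    p ·× (q ·× x) ≈⟨ char _ ⟩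
    0# ∎

  -- Only the two extreme binomial terms survive, the inner coefficients being multiples of p.
  -- Multiplication in `R` may be non-commutative, so x and y are assumed to commute.
  frobenius : ∀ {p} → Prime p → (∀ x → p ·× x ≈ 0#) →
    ∀ x y → x ⊠ y ≈ y ⊠ x → (x ⊞ y) ↑ p ≈ x ↑ p ⊞ y ↑ p
  frobenius {zero} pr = contradiction pr ¬prime[0]
  frobenius {suc m} pr char x y xy = begin
    (x ⊞ y) ↑ suc m            ≈⟨ B.theorem x y xy (suc m) ⟩
    ∑ᶠ t                      ≈⟨ +-congˡ (sum-init-last (λ i → t (suc i))) ⟩
    t zero ⊞ (∑ᶠ u ⊞ t (suc (fromℕ m))) ≈⟨ +-cong first (+-cong middle last) ⟩
    y ↑ suc m ⊞ (0# ⊞ x ↑ suc m) ≈⟨ +-congˡ (+-identityˡ _) ⟩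
    y ↑ suc m ⊞ x ↑ suc m      ≈⟨ +-comm _ _ ⟩
    x ↑ suc m ⊞ y ↑ suc m ∎
    where
    t = B.binomialTerm x y (suc m)
    u : Fin m → Carrier
    u i = t (suc (inject₁ i))
    first : t zero ≈ y ↑ suc m
    first = ≈-trans (×-homo-1 _) (*-identityˡ _)
    middle : ∑ᶠ u ≈ 0#
    middle = ≈-trans (sum-cong-≋ {m} {u} λ i → ∣⇒×≈0 char (p∣pCk pr (s≤s z≤n)
      (s≤s (subst (_< m) (sym (toℕ-inject₁ i)) (toℕ<n i)))) _) (sum-replicate-zero m)
    last : t (suc (fromℕ m)) ≈ x ↑ suc m
    last rewrite toℕ-fromℕ m | nCn≡1 (suc m) | ℕₚ.n∸n≡0 m =
      ≈-trans (×-homo-1 _) (*-identityʳ _)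

-- The semiring of endomorphisms of a commutative monoid

module Endo {a ℓ} (M : CommutativeMonoid a ℓ) where
  open CommutativeMonoid M
    renaming (_∙_ to _⊹_; ε to 0ᴹ; ∙-cong to ⊹-cong; refl to ≈-refl; sym to ≈-sym; trans to ≈-trans)
  open import Relation.Binary.Reasoning.Setoid setoid
  open import Algebra.Properties.CommutativeSemigroup commutativeSemigroup
    using () renaming (interchange to ⊹-interchange)
  open import Level using (_⊔_)

  -- Addition in a monoid may fail to be cancellative, so preservation of 0 does not follow from
  -- `add` and is recorded as `null`.
  record End : Set (a ⊔ ℓ) where
    field
      app  : Carrier → Carrier
      resp : ∀ {f g} → f ≈ g → app f ≈ app g
      add  : ∀ f g → app (f ⊹ g) ≈ app f ⊹ app g
      null : app 0ᴹ ≈ 0ᴹ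
  open End public

  infixl 6 _⊞_
  infixl 7 _⊠_

  _⊞_ _⊠_ : End → End → End
  (A ⊞ B) .app f = app A f ⊹ app B f
  (A ⊞ B) .resp e = ⊹-cong (resp A e) (resp B e)
  (A ⊞ B) .add f g = begin
      app A (f ⊹ g) ⊹ app B (f ⊹ g)             ≈⟨ ⊹-cong (add A f g) (add B f g) ⟩
      (app A f ⊹ app A g) ⊹ (app B f ⊹ app B g) ≈⟨ ⊹-interchange _ _ _ _ ⟩
      (app A f ⊹ app B f) ⊹ (app A g ⊹ app B g) ∎
  (A ⊞ B) .null = ≈-trans (⊹-cong (null A) (null B)) (identityˡ 0ᴹ)
  (A ⊠ B) .app f = app A (app B f)
  (A ⊠ B) .resp e = resp A (resp B e)
  (A ⊠ B) .add f g = ≈-trans (resp A (add B f g)) (add A _ _)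
  (A ⊠ B) .null = ≈-trans (resp A (null B)) (null A)

  0ᴱ 1ᴱ : End
  0ᴱ = record { app = λ _ → 0ᴹ ; resp = λ _ → ≈-refl
              ; add = λ _ _ → ≈-sym (identityˡ 0ᴹ) ; null = ≈-refl }
  1ᴱ = record { app = λ f → f ; resp = λ e → e
              ; add = λ _ _ → ≈-refl ; null = ≈-refl }

  semiring : Semiring (a ⊔ ℓ) (a ⊔ ℓ)
  semiring = record
    { Carrier = End
    ; _≈_ = λ A B → ∀ f → app A f ≈ app B f
    ; _+_ = _⊞_ ; _*_ = _⊠_ ; 0# = 0ᴱ ; 1# = 1ᴱ
    ; isSemiring = record
      { isSemiringWithoutAnnihilatingZero = record
        { +-isCommutativeMonoid = record
          { isMonoid = record
            { isSemigroup = record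
              { isMagma = record
                { isEquivalence = record
                  { refl = λ _ → ≈-refl
                  ; sym = λ e f → ≈-sym (e f)
                  ; trans = λ d e f → ≈-trans (d f) (e f) }
                ; ∙-cong = λ d e f → ⊹-cong (d f) (e f) }
              ; assoc = λ _ _ _ _ → assoc _ _ _ }
            ; identity = (λ _ _ → identityˡ _) , (λ _ _ → identityʳ _) }
          ; comm = λ _ _ _ → comm _ _ }
        ; *-cong = λ {A} d e f → ≈-trans (resp A (e f)) (d _)
        ; *-assoc = λ _ _ _ _ → ≈-refl
        ; *-identity = (λ _ _ → ≈-refl) , (λ _ _ → ≈-refl)
        ; distrib = (λ A _ _ _ → add A _ _) , (λ _ _ _ _ → ≈-refl) }
      ; zero = (λ _ _ → ≈-refl) , (λ A _ → null A) } }

-- Finite sums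

∑ : List I → (I → ℕ) → ℕ
∑ L f = sum (map f L)

∑-cong : ∀ (L : List I) {f g} → (∀ x → f x ≡ g x) → ∑ L f ≡ ∑ L g
∑-cong L e = cong sum (Listₚ.map-cong e L)

∑-++ : ∀ (L M : List I) f → ∑ (L ++ M) f ≡ ∑ L f + ∑ M f
∑-++ L M f = trans (cong sum (Listₚ.map-++ f L M)) (sum-++ (map f L) (map f M))

∑-map : ∀ (h : J → I) L f → ∑ (map h L) f ≡ ∑ L (f ∘ h)
∑-map h L f = cong sum (sym (Listₚ.map-∘ L))

∑-+ : ∀ (L : List I) f g → ∑ L (λ x → f x + g x) ≡ ∑ L f + ∑ L g
∑-+ [] f g = refl
∑-+ (x ∷ L) f g = trans (cong (_+_ (f x + g x)) (∑-+ L f g)) (interchange (f x) (g x) _ _)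

∑-const : ∀ (L : List I) k → ∑ L (λ _ → k) ≡ length L * k
∑-const [] k = refl
∑-const (x ∷ L) k = cong (_+_ k) (∑-const L k)

∑-* : ∀ (L : List I) k f → ∑ L (λ x → k * f x) ≡ k * ∑ L f
∑-* [] k f = sym (ℕₚ.*-zeroʳ k)
∑-* (x ∷ L) k f = trans (cong (_+_ (k * f x)) (∑-* L k f)) (sym (ℕₚ.*-distribˡ-+ k (f x) _))

∑-swap : ∀ (L : List I) (M : List J) (f : I → J → ℕ) →
  ∑ L (λ x → ∑ M (f x)) ≡ ∑ M (λ y → ∑ L (λ x → f x y))
∑-swap [] M f = sym (trans (∑-const M 0) (ℕₚ.*-zeroʳ (length M)))
∑-swap (x ∷ L) M f = trans (cong (_+_ (∑ M (f x))) (∑-swap L M f))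
  (sym (∑-+ M (f x) (λ y → ∑ L (λ w → f w y))))

∑-mono : ∀ (L : List I) {f g} → (∀ x → f x ≤ g x) → ∑ L f ≤ ∑ L g
∑-mono [] le = z≤n
∑-mono (x ∷ L) le = ℕₚ.+-mono-≤ (le x) (∑-mono L le)

∑-allFin-suc : ∀ (f : Fin (suc n) → ℕ) → ∑ (allFin (suc n)) f ≡ f zero + ∑ (allFin n) (f ∘ suc)
∑-allFin-suc f = cong (λ l → f zero + sum l)
  (trans (Listₚ.map-tabulate suc f) (sym (Listₚ.map-tabulate (λ i → i) (f ∘ suc))))

𝟙 : {P : Set} → Dec P → ℕ
𝟙 (yes _) = 1
𝟙 (no _)  = 0

𝟙-cong : {P Q : Set} (p : Dec P) (q : Dec Q) → (P → Q) → (Q → P) → 𝟙 p ≡ 𝟙 q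
𝟙-cong (yes _) (yes _) f g = refl
𝟙-cong (yes p) (no ¬q) f g = contradiction (f p) ¬q
𝟙-cong (no ¬p) (yes q) f g = contradiction (g q) ¬p
𝟙-cong (no _) (no _) f g = refl

∑𝟙≡0 : ∀ {L : List I} {P : Pred I _} (P? : Decidable P) → All (¬_ ∘ P) L → ∑ L (𝟙 ∘ P?) ≡ 0
∑𝟙≡0 P? [] = refl
∑𝟙≡0 {L = x ∷ _} P? (¬p ∷ r) with P? x
... | yes p = contradiction p ¬p
... | no _  = ∑𝟙≡0 P? r

∑𝟙≡1 : ∀ {L : List I} {P : Pred I _} (P? : Decidable P) → Unique L → ∀ {u} → u ∈ L → P u →
  (∀ {v} → v ∈ L → P v → v ≡ u) → ∑ L (𝟙 ∘ P?) ≡ 1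
∑𝟙≡1 {L = x ∷ L} {P} P? (x∉ ∷ un) (here refl) pu only with P? x
... | no ¬p = contradiction pu ¬p
... | yes _ = cong suc (∑𝟙≡0 P? (All.tabulate λ v∈ pv →
  All.lookup x∉ v∈ (sym (only (there v∈) pv))))
∑𝟙≡1 {L = x ∷ L} P? (x∉ ∷ un) (there u∈) pu only with P? x
... | yes px = contradiction (only (here refl) px) (All.lookup x∉ u∈)
... | no _ = ∑𝟙≡1 P? un u∈ pu (λ v∈ → only (there v∈))

-- The lattice ℤⁿ and the shape Υₙ

0ᵥ : Point n
0ᵥ = replicate _ 0ℤ

infixr 8 _•_
_•_ : ℤ → Point n → Point n
k • z = Vec.map (k ℤ.*_) z

⊖_ : Point n → Point n
⊖ z = -1ℤ • z

⊕-assoc : ∀ (x y z : Point n) → (x ⊕ y) ⊕ z ≡ x ⊕ (y ⊕ z)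
⊕-assoc = Vecₚ.zipWith-assoc ℤₚ.+-assoc

⊕-comm : ∀ (x y : Point n) → x ⊕ y ≡ y ⊕ x
⊕-comm = Vecₚ.zipWith-comm ℤₚ.+-comm

⊕-identityˡ : ∀ (x : Point n) → 0ᵥ ⊕ x ≡ x
⊕-identityˡ = Vecₚ.zipWith-identityˡ ℤₚ.+-identityˡ

⊕-identityʳ : ∀ (x : Point n) → x ⊕ 0ᵥ ≡ x
⊕-identityʳ = Vecₚ.zipWith-identityʳ ℤₚ.+-identityʳ

•-distribˡ : ∀ k (x y : Point n) → k • (x ⊕ y) ≡ (k • x) ⊕ (k • y)
•-distribˡ k [] [] = refl
•-distribˡ k (a ∷ x) (b ∷ y) = cong₂ _∷_ (ℤₚ.*-distribˡ-+ k a b) (•-distribˡ k x y)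

•-distribʳ : ∀ k l (x : Point n) → (k ℤ.+ l) • x ≡ (k • x) ⊕ (l • x)
•-distribʳ k l [] = refl
•-distribʳ k l (a ∷ x) = cong₂ _∷_ (ℤₚ.*-distribʳ-+ a k l) (•-distribʳ k l x)

•-assoc : ∀ k l (x : Point n) → (k ℤ.* l) • x ≡ k • (l • x)
•-assoc k l [] = refl
•-assoc k l (a ∷ x) = cong₂ _∷_ (ℤₚ.*-assoc k l a) (•-assoc k l x)

1•_ : ∀ (x : Point n) → 1ℤ • x ≡ x
1•_ [] = refl
1•_ (a ∷ x) = cong₂ _∷_ (ℤₚ.*-identityˡ a) (1• x)

0•_ : ∀ (x : Point n) → 0ℤ • x ≡ 0ᵥ
0•_ [] = refl
0•_ (a ∷ x) = cong (0ℤ ∷_) (0• x)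

•0ᵥ : ∀ k → k • 0ᵥ {n} ≡ 0ᵥ
•0ᵥ {zero} k = refl
•0ᵥ {suc n} k = cong₂ _∷_ (ℤₚ.*-zeroʳ k) (•0ᵥ k)

⊕-inverseʳ : ∀ (x : Point n) → x ⊕ (⊖ x) ≡ 0ᵥ
⊕-inverseʳ x = trans (cong (_⊕ (⊖ x)) (sym (1• x))) (trans (sym (•-distribʳ 1ℤ -1ℤ x)) (0• x))

⊖-involutive : ∀ (x : Point n) → ⊖ ⊖ x ≡ x
⊖-involutive x = trans (sym (•-assoc -1ℤ -1ℤ x)) (1• x)

x⊕y⊖y : ∀ (x y : Point n) → (x ⊕ y) ⊕ (⊖ y) ≡ x
x⊕y⊖y x y = trans (⊕-assoc x y _) (trans (cong (x ⊕_) (⊕-inverseʳ y)) (⊕-identityʳ x))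

unit : Fin n → Point n
unit zero    = 1ℤ ∷ 0ᵥ
unit (suc i) = 0ℤ ∷ unit i

layer : ℤ → List (Point n) → List (Point (suc n))
layer a = map (a ∷_)

cube : ∀ n → List (Point n)
cube zero    = [] ∷ []
cube (suc n) = layer 0ℤ (cube n) ++ layer -1ℤ (cube n)

-- the cells attached to the two facets of the cube orthogonal to the i-th axis
arm : Fin n → List (Point n)
arm zero    = layer 1ℤ (cube _) ++ layer (ℤ.- (+ 2)) (cube _)
arm (suc i) = layer 0ℤ (arm i) ++ layer -1ℤ (arm i)

-- Υₙ without repetition, sorted by first coordinate: at 0 and -1 the unit of distance is still free
-- for the tail, at 1 and -2 it is spent and the tail must lie in the cube.
tile : ∀ n → List (Point n)
tile zero    = [] ∷ []
tile (suc n) = (layer 0ℤ (tile n) ++ layer -1ℤ (tile n)) ++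
               (layer 1ℤ (cube n) ++ layer (ℤ.- (+ 2)) (cube n))

length-cube-suc : ∀ n → length (cube (suc n)) ≡ length (cube n) + length (cube n)
length-cube-suc n = trans (Listₚ.length-++ (layer 0ℤ (cube n)))
  (cong₂ _+_ (Listₚ.length-map (0ℤ ∷_) (cube n)) (Listₚ.length-map (-1ℤ ∷_) (cube n)))

∑-layers : ∀ a b (L M : List (Point n)) f →
  ∑ (layer a L ++ layer b M) f ≡ ∑ L (f ∘ (a ∷_)) + ∑ M (f ∘ (b ∷_))
∑-layers a b L M f = trans (∑-++ (layer a L) (layer b M) f)
  (cong₂ _+_ (∑-map (a ∷_) L f) (∑-map (b ∷_) M f))

-- By induction: the layers 0 and -1 of the tile split into lower cubes and lower arms, which are
-- the layers of the cube and of each `arm (suc i)`; the two outer layers form `arm zero`.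
∑-tile : ∀ n f → ∑ (tile n) f ≡ ∑ (cube n) f + ∑ (allFin n) (λ i → ∑ (arm i) f)
∑-tile zero f = sym (ℕₚ.+-identityʳ _)
∑-tile (suc n) f = begin
  ∑ (tile (suc n)) f
    ≡⟨ ∑-++ (layer 0ℤ (tile n) ++ layer -1ℤ (tile n)) (arm zero) f ⟩
  ∑ (layer 0ℤ (tile n) ++ layer -1ℤ (tile n)) f + a₀
    ≡⟨ cong (_+ a₀) (∑-layers 0ℤ -1ℤ (tile n) (tile n) f) ⟩
  ∑ (tile n) f₀ + ∑ (tile n) f₁ + a₀
    ≡⟨ cong (_+ a₀) (cong₂ _+_ (∑-tile n f₀) (∑-tile n f₁)) ⟩
  (c f₀ + r f₀) + (c f₁ + r f₁) + a₀
    ≡⟨ cong (_+ a₀) (interchange (c f₀) (r f₀) (c f₁) (r f₁)) ⟩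
  (c f₀ + c f₁) + (r f₀ + r f₁) + a₀
    ≡⟨ ℕₚ.+-assoc (c f₀ + c f₁) _ a₀ ⟩
  (c f₀ + c f₁) + ((r f₀ + r f₁) + a₀)
    ≡⟨ cong₂ _+_ (sym (∑-layers 0ℤ -1ℤ (cube n) (cube n) f)) (ℕₚ.+-comm _ a₀) ⟩
  ∑ (cube (suc n)) f + (a₀ + (r f₀ + r f₁))
    ≡⟨ cong (λ k → ∑ (cube (suc n)) f + (a₀ + k)) (sym (∑-+ (allFin n) _ _)) ⟩
  ∑ (cube (suc n)) f + (a₀ + ∑ (allFin n) (λ i → ∑ (arm i) f₀ + ∑ (arm i) f₁))
    ≡⟨ cong (λ k → ∑ (cube (suc n)) f + (a₀ + k))
         (∑-cong (allFin n) λ i → sym (∑-layers 0ℤ -1ℤ (arm i) (arm i) f)) ⟩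
  ∑ (cube (suc n)) f + (a₀ + ∑ (allFin n) (λ i → ∑ (arm (suc i)) f))
    ≡⟨ cong (_+_ (∑ (cube (suc n)) f)) (sym (∑-allFin-suc (λ i → ∑ (arm i) f))) ⟩
  ∑ (cube (suc n)) f + ∑ (allFin (suc n)) (λ i → ∑ (arm i) f) ∎
  where
  open ≡-Reasoning
  a₀ = ∑ (arm zero) f
  f₀ f₁ : Point n → ℕ
  f₀ = f ∘ (0ℤ ∷_)
  f₁ = f ∘ (-1ℤ ∷_)
  c r : (Point n → ℕ) → ℕ
  c = ∑ (cube n)
  r g = ∑ (allFin n) (λ i → ∑ (arm i) g)

-- The two shifts of the cube along axis i occupy the layers 1, 0 and -1, -2. The inner layers make
-- up the cube again and the outer ones the arm: this is x + x⁻² = (1 + x⁻¹)(x - 1 + x⁻¹) with the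
-- subtraction moved across.
∑-cube-neighbours : ∀ (i : Fin n) f →
  ∑ (cube n) (λ c → f (c ⊕ unit i) + f (c ⊕ (⊖ unit i))) ≡ ∑ (cube n) f + ∑ (arm i) f
∑-cube-neighbours {suc n} zero f = begin
  ∑ (cube (suc n)) (λ c → f (c ⊕ unit zero) + f (c ⊕ (⊖ unit zero)))
    ≡⟨ ∑-layers 0ℤ -1ℤ (cube n) (cube n) _ ⟩
  ∑ (cube n) (λ c → f (1ℤ ∷ (c ⊕ 0ᵥ)) + f (-1ℤ ∷ (c ⊕ (⊖ 0ᵥ)))) +
  ∑ (cube n) (λ c → f (0ℤ ∷ (c ⊕ 0ᵥ)) + f ((ℤ.- (+ 2)) ∷ (c ⊕ (⊖ 0ᵥ))))
    ≡⟨ cong₂ _+_ (both 1ℤ -1ℤ) (both 0ℤ (ℤ.- (+ 2))) ⟩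
  (s 1ℤ + s -1ℤ) + (s 0ℤ + s (ℤ.- (+ 2)))
    ≡⟨ cong (_+ (s 0ℤ + s (ℤ.- (+ 2)))) (ℕₚ.+-comm (s 1ℤ) (s -1ℤ)) ⟩
  (s -1ℤ + s 1ℤ) + (s 0ℤ + s (ℤ.- (+ 2)))
    ≡⟨ interchange (s -1ℤ) _ _ _ ⟩
  (s -1ℤ + s 0ℤ) + (s 1ℤ + s (ℤ.- (+ 2)))
    ≡⟨ cong₂ _+_ (trans (ℕₚ.+-comm (s -1ℤ) _) (sym (∑-layers 0ℤ -1ℤ (cube n) (cube n) f)))
         (sym (∑-layers 1ℤ (ℤ.- (+ 2)) (cube n) (cube n) f)) ⟩
  ∑ (cube (suc n)) f + ∑ (arm zero) f ∎
  where
  open ≡-Reasoning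
  s : ℤ → ℕ
  s a = ∑ (cube n) (f ∘ (a ∷_))
  both : ∀ a b → ∑ (cube n) (λ c → f (a ∷ (c ⊕ 0ᵥ)) + f (b ∷ (c ⊕ (⊖ 0ᵥ)))) ≡ s a + s b
  both a b = trans (∑-cong (cube n) λ c → cong₂ _+_ (cong (f ∘ (a ∷_)) (⊕-identityʳ c))
    (cong (f ∘ (b ∷_)) (trans (cong (c ⊕_) (•0ᵥ -1ℤ)) (⊕-identityʳ c)))) (∑-+ (cube n) _ _)
∑-cube-neighbours {suc n} (suc i) f = begin
  ∑ (cube (suc n)) (λ c → f (c ⊕ unit (suc i)) + f (c ⊕ (⊖ unit (suc i))))
    ≡⟨ ∑-layers 0ℤ -1ℤ (cube n) (cube n) _ ⟩
  ∑ (cube n) (λ c → f₀ (c ⊕ unit i) + f₀ (c ⊕ (⊖ unit i))) +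
  ∑ (cube n) (λ c → f₁ (c ⊕ unit i) + f₁ (c ⊕ (⊖ unit i)))
    ≡⟨ cong₂ _+_ (∑-cube-neighbours i f₀) (∑-cube-neighbours i f₁) ⟩
  (∑ (cube n) f₀ + ∑ (arm i) f₀) + (∑ (cube n) f₁ + ∑ (arm i) f₁)
    ≡⟨ interchange (∑ (cube n) f₀) _ _ _ ⟩
  (∑ (cube n) f₀ + ∑ (cube n) f₁) + (∑ (arm i) f₀ + ∑ (arm i) f₁)
    ≡⟨ cong₂ _+_ (sym (∑-layers 0ℤ -1ℤ (cube n) (cube n) f)) (sym (∑-layers 0ℤ -1ℤ (arm i) (arm i) f)) ⟩
  ∑ (cube (suc n)) f + ∑ (arm (suc i)) f ∎
  where
  open ≡-Reasoning
  f₀ f₁ : Point n → ℕ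
  f₀ = f ∘ (0ℤ ∷_)
  f₁ = f ∘ (-1ℤ ∷_)

length-arm : ∀ (i : Fin n) → length (arm i) ≡ length (cube n)
length-arm {n} i = sym (ℕₚ.+-cancelˡ-≡ (length (cube n)) _ _ (begin
  length (cube n) + length (cube n)           ≡⟨ cong₂ _+_ (∑1 (cube n)) (∑1 (cube n)) ⟨
  ∑ (cube n) (λ _ → 1) + ∑ (cube n) (λ _ → 1) ≡⟨ ∑-+ (cube n) _ _ ⟨
  ∑ (cube n) (λ _ → 1 + 1)                    ≡⟨ ∑-cube-neighbours i (λ _ → 1) ⟩
  ∑ (cube n) (λ _ → 1) + ∑ (arm i) (λ _ → 1)  ≡⟨ cong₂ _+_ (∑1 (cube n)) (∑1 (arm i)) ⟩
  length (cube n) + length (arm i) ∎))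
  where
  open ≡-Reasoning
  ∑1 : ∀ (L : List (Point n)) → ∑ L (λ _ → 1) ≡ length L
  ∑1 L = trans (∑-const L 1) (ℕₚ.*-identityʳ _)

layers-unique : ∀ {a b} {L M : List (Point n)} → a ≢ b → Unique L → Unique M →
  Unique (layer a L ++ layer b M)
layers-unique {a = a} {b} {L} {M} a≢b uL uM =
  Uniqueₚ.++⁺ (Uniqueₚ.map⁺ Vecₚ.∷-injectiveʳ uL) (Uniqueₚ.map⁺ Vecₚ.∷-injectiveʳ uM) disjoint
  where
  disjoint : Disjoint (layer a L) (layer b M)
  disjoint (p , q) with _ , _ , refl ← ∈-map⁻ (a ∷_) p | _ , _ , e ← ∈-map⁻ (b ∷_) q =
    a≢b (Vecₚ.∷-injectiveˡ e)

cube-unique : ∀ n → Unique (cube n)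
cube-unique zero = [] ∷ []
cube-unique (suc n) = layers-unique (λ ()) (cube-unique n) (cube-unique n)

∈-layers⁻ : ∀ {a b c} {z : Point n} {L M} → (c ∷ z) ∈ layer a L ++ layer b M →
  (c ≡ a × z ∈ L) ⊎ (c ≡ b × z ∈ M)
∈-layers⁻ {a = a} {b} {L = L} p with ∈-++⁻ (layer a L) p
... | inj₁ q with _ , w , refl ← ∈-map⁻ (a ∷_) q = inj₁ (refl , w)
... | inj₂ q with _ , w , refl ← ∈-map⁻ (b ∷_) q = inj₂ (refl , w)

∈-layers⁺ˡ : ∀ {a b} {z : Point n} {L M} → z ∈ L → (a ∷ z) ∈ layer a L ++ layer b M
∈-layers⁺ˡ {a = a} p = ∈-++⁺ˡ (∈-map⁺ (a ∷_) p)

∈-layers⁺ʳ : ∀ {a b} {z : Point n} {L M} → z ∈ M → (b ∷ z) ∈ layer a L ++ layer b M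
∈-layers⁺ʳ {a = a} {b = b} {L = L} p = ∈-++⁺ʳ (layer a L) (∈-map⁺ (b ∷_) p)

0ᵥ∈cube : ∀ n → 0ᵥ ∈ cube n
0ᵥ∈cube zero    = here refl
0ᵥ∈cube (suc n) = ∈-layers⁺ˡ (0ᵥ∈cube n)

tile-unique : ∀ n → Unique (tile n)
tile-unique zero = [] ∷ []
tile-unique (suc n) = Uniqueₚ.++⁺ (layers-unique (λ ()) (tile-unique n) (tile-unique n))
  (layers-unique (λ ()) (cube-unique n) (cube-unique n)) disjoint
  where
  disjoint : Disjoint (layer 0ℤ (tile n) ++ layer -1ℤ (tile n)) (arm zero)
  disjoint {c ∷ z} (p , q) with ∈-layers⁻ {L = tile n} {tile n} p | ∈-layers⁻ {L = cube n} {cube n} q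
  ... | inj₁ (refl , _) | inj₁ (() , _)
  ... | inj₁ (refl , _) | inj₂ (() , _)
  ... | inj₂ (refl , _) | inj₁ (() , _)
  ... | inj₂ (refl , _) | inj₂ (() , _)

∈cube⇒InCube : ∀ {c : Point n} → c ∈ cube n → InCube c
∈cube⇒InCube {c = []} _ = []
∈cube⇒InCube {suc n} {a ∷ c} p with ∈-layers⁻ {L = cube n} {cube n} p
... | inj₁ (e , q) = inj₂ e ∷ ∈cube⇒InCube q
... | inj₂ (e , q) = inj₁ e ∷ ∈cube⇒InCube q

InCube⇒∈cube : ∀ {c : Point n} → InCube c → c ∈ cube n
InCube⇒∈cube [] = here refl
InCube⇒∈cube (inj₁ refl ∷ p) = ∈-layers⁺ʳ {L = cube _} (InCube⇒∈cube p)
InCube⇒∈cube (inj₂ refl ∷ p) = ∈-layers⁺ˡ (InCube⇒∈cube p)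

dist₁-refl : ∀ (c : Point n) → dist₁ c c ≡ 0
dist₁-refl [] = refl
dist₁-refl (a ∷ c) rewrite ℤₚ.+-inverseʳ a = dist₁-refl c

dist₁≡0 : ∀ (x u : Point n) → dist₁ x u ≡ 0 → x ≡ u
dist₁≡0 [] [] _ = refl
dist₁≡0 (a ∷ x) (b ∷ u) e = cong₂ _∷_
  (ℤₚ.i-j≡0⇒i≡j a b (ℤₚ.∣i∣≡0⇒i≡0 (ℕₚ.m+n≡0⇒m≡0 _ e))) (dist₁≡0 x u (ℕₚ.m+n≡0⇒n≡0 _ e))

cube⊆tile : ∀ {c : Point n} → c ∈ cube n → c ∈ tile n
cube⊆tile {c = []} p = p
cube⊆tile {suc n} {a ∷ c} p with ∈-layers⁻ {L = cube n} {cube n} p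
... | inj₁ (refl , q) = ∈-++⁺ˡ (∈-layers⁺ˡ (cube⊆tile q))
... | inj₂ (refl , q) = ∈-++⁺ˡ (∈-layers⁺ʳ {L = tile _} (cube⊆tile q))

∈tile⇒Upsilon : ∀ {u : Point n} → u ∈ tile n → Upsilon n u
∈tile⇒Upsilon {u = []} p = [] , [] , z≤n
∈tile⇒Upsilon {suc n} {u = a ∷ u} p with ∈-++⁻ (layer 0ℤ (tile n) ++ layer -1ℤ (tile n)) p
... | inj₁ q with ∈-layers⁻ {L = tile n} {tile n} q
...   | inj₁ (refl , r) with x , ic , d ← ∈tile⇒Upsilon r = 0ℤ ∷ x , inj₂ refl ∷ ic , d
...   | inj₂ (refl , r) with x , ic , d ← ∈tile⇒Upsilon r = -1ℤ ∷ x , inj₁ refl ∷ ic , d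
∈tile⇒Upsilon {suc n} {u = a ∷ u} p | inj₂ q with ∈-layers⁻ {L = cube n} {cube n} q
...   | inj₁ (refl , r) = 0ℤ ∷ u , inj₂ refl ∷ ∈cube⇒InCube r , s≤s (ℕₚ.≤-reflexive (dist₁-refl u))
...   | inj₂ (refl , r) = -1ℤ ∷ u , inj₁ refl ∷ ∈cube⇒InCube r , s≤s (ℕₚ.≤-reflexive (dist₁-refl u))

Upsilon⇒∈tile : ∀ {u : Point n} → Upsilon n u → u ∈ tile n
Upsilon⇒∈tile {u = []} _ = here refl
Upsilon⇒∈tile {suc n} {u = a ∷ u} (x₀ ∷ x , c₀ ∷ ic , d) = go a c₀ d
  where
  -- If the first coordinate already uses distance 1, the tails x and u agree, so u lies in the
  -- cube.
  far : dist₁ x u ≤ 0 → u ∈ cube n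
  far le with refl ← dist₁≡0 x u (ℕₚ.n≤0⇒n≡0 le) = InCube⇒∈cube ic
  in₀ : u ∈ tile n → (0ℤ ∷ u) ∈ tile (suc n)
  in₀ p = ∈-++⁺ˡ (∈-layers⁺ˡ p)
  in₋₁ : u ∈ tile n → (-1ℤ ∷ u) ∈ tile (suc n)
  in₋₁ p = ∈-++⁺ˡ (∈-layers⁺ʳ {L = tile n} p)
  out : ∀ {z} → z ∈ arm zero → z ∈ tile (suc n)
  out p = ∈-++⁺ʳ (layer 0ℤ (tile n) ++ layer -1ℤ (tile n)) p
  go : ∀ a → x₀ ≡ -1ℤ ⊎ x₀ ≡ 0ℤ → ℤ.∣ x₀ ℤ.- a ∣ + dist₁ x u ≤ 1 → (a ∷ u) ∈ tile (suc n)
  -- Moving between -1 and 0 stays in the inner layers, where a tail in the cube is also in the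
  -- smaller tile; only 1 and -2 lead into the arm.
  go (+ 0)           (inj₁ refl) (s≤s d) = in₀ (cube⊆tile (far d))
  go (+ suc _)       (inj₁ refl) (s≤s ())
  go -[1+ 0 ]        (inj₁ refl) d = in₋₁ (Upsilon⇒∈tile (x , ic , d))
  go -[1+ 1 ]        (inj₁ refl) (s≤s d) = out (∈-layers⁺ʳ {L = cube n} (far d))
  go -[1+ suc (suc _) ] (inj₁ refl) (s≤s ())
  go (+ 0)           (inj₂ refl) d = in₀ (Upsilon⇒∈tile (x , ic , d))
  go (+ 1)           (inj₂ refl) (s≤s d) = out (∈-layers⁺ˡ (far d))
  go (+ suc (suc _)) (inj₂ refl) (s≤s ())
  go -[1+ 0 ]        (inj₂ refl) (s≤s d) = in₋₁ (cube⊆tile (far d))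
  go -[1+ suc _ ]    (inj₂ refl) (s≤s ())

-- Convolution with finite sets of translations

module _ (G H : ℕ → ℕ) (k : ℕ) (step : ∀ j → G j + G (suc j) ≡ H j + H (suc j) + k) where

  private
    -- With D = G - H, `step` reads D j + D (1 + j) = k. Comparing two consecutive instances gives D
    -- (2 + j) = D j, stated without subtraction because the values are natural numbers.
    two-apart : ∀ j → G j + H (2 + j) ≡ G (2 + j) + H j
    two-apart j = ℕₚ.+-cancelˡ-≡ (G (suc j) + H (suc j) + k) _ _ (begin
      b + e + k + (a + f)        ≡⟨ l₁ a b e f k ⟩
      (a + b) + (e + f + k)      ≡⟨ cong₂ _+_ (step j) (sym (step (suc j))) ⟩
      (d + e + k) + (b + c)      ≡⟨ l₂ b c d e k ⟩
      b + e + k + (c + d) ∎)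
      where
      open ≡-Reasoning
      a = G j
      b = G (suc j)
      c = G (2 + j)
      d = H j
      e = H (suc j)
      f = H (2 + j)
      l₁ : ∀ a b e f k → b + e + k + (a + f) ≡ (a + b) + (e + f + k)
      l₁ = solve-∀
      l₂ : ∀ b c d e k → (d + e + k) + (b + c) ≡ b + e + k + (c + d)
      l₂ = solve-∀

    -- The base point is 1 rather than 0 so that even steps reach the odd period 1 + 2r, where G and
    -- H return to their values at 0.
    even-apart : ∀ r → G 1 + H (1 + r * 2) ≡ G (1 + r * 2) + H 1
    even-apart zero = refl
    even-apart (suc r) = ℕₚ.+-cancelʳ-≡ (G y + H y) _ _ (begin
      (G 1 + H x) + (G y + H y)    ≡⟨ l (G 1) (H x) (G y) (H y) ⟩
      (G 1 + H y) + (G y + H x)    ≡⟨ cong₂ _+_ (even-apart r) (two-apart y) ⟩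
      (G y + H 1) + (G x + H y)    ≡⟨ l′ (G y) (H 1) (G x) (H y) ⟩
      (G x + H 1) + (G y + H y) ∎)
      where
      open ≡-Reasoning
      y = 1 + r * 2
      x = 2 + y
      l : ∀ a b c d → (a + b) + (c + d) ≡ (a + d) + (c + b)
      l = solve-∀
      l′ : ∀ a b c d → (a + b) + (c + d) ≡ (c + b) + (a + d)
      l′ = solve-∀

  -- The difference G − H has period 2 and odd period 1 + 2r, hence is constant.
  odd-period⇒halve : ∀ r → G (1 + r * 2) ≡ G 0 → H (1 + r * 2) ≡ H 0 →
    2 * G 0 ≡ 2 * H 0 + k
  odd-period⇒halve r g h = ℕₚ.+-cancelʳ-≡ (H 1) _ _ (begin
    2 * G 0 + H 1                    ≡⟨ l (G 0) (H 1) ⟩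
    G 0 + (G 0 + H 1)                ≡⟨ cong (λ w → G 0 + (w + H 1)) g ⟨
    G 0 + (G (1 + r * 2) + H 1)  ≡⟨ cong (_+_ (G 0)) (even-apart r) ⟨
    G 0 + (G 1 + H (1 + r * 2))  ≡⟨ cong (λ w → G 0 + (G 1 + w)) h ⟩
    G 0 + (G 1 + H 0)                ≡⟨ ℕₚ.+-assoc (G 0) (G 1) (H 0) ⟨
    G 0 + G 1 + H 0                  ≡⟨ cong (_+ H 0) (step 0) ⟩
    H 0 + H 1 + k + H 0            ≡⟨ l′ (H 0) (H 1) k ⟩
    2 * H 0 + k + H 1 ∎)
    where
    open ≡-Reasoning
    l : ∀ a b → 2 * a + b ≡ a + (a + b)
    l = solve-∀
    l′ : ∀ a b k → a + b + k + a ≡ 2 * a + k + b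
    l′ = solve-∀

infixr 8 _⋆_
-- With `cube n` on the left this is the operator P, with `axes n` the operator S.
_⋆_ : List (Point n) → (Point n → ℕ) → Point n → ℕ
(L ⋆ f) z = ∑ L (λ v → f (z ⊕ v))

⋆-comm : ∀ (L M : List (Point n)) f z → (L ⋆ (M ⋆ f)) z ≡ (M ⋆ (L ⋆ f)) z
⋆-comm L M f z = trans (∑-swap L M (λ v w → f ((z ⊕ v) ⊕ w)))
  (∑-cong M λ w → ∑-cong L λ v → cong f
    (trans (⊕-assoc z v w) (trans (cong (z ⊕_) (⊕-comm v w)) (sym (⊕-assoc z w v)))))

Periodic : ℕ → (Point n → ℕ) → Set
Periodic q f = ∀ i z → f (z ⊕ ((+ q) • unit i)) ≡ f z

-- P is inverted one coordinate at a time. For a fixed tail, the layer sums along the first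
-- coordinate satisfy the hypotheses of `odd-period⇒halve`, which removes that coordinate at the
-- cost of a factor 2. This factor is absorbed into the functions given to the induction hypothesis;
-- in the end the factors multiply to 2ⁿ, the length of the cube.
∑-cube-injective : ∀ n r (f g : Point n → ℕ) k → let q = 1 + r * 2 in
  Periodic q f → Periodic q g → (∀ z → (cube n ⋆ f) z ≡ (cube n ⋆ g) z + k) →
  ∀ z → length (cube n) * f z ≡ length (cube n) * g z + k
∑-cube-injective zero r f g k pf pg eq [] = eq []
∑-cube-injective (suc n) r f g k pf pg eq (x ∷ z) = begin
  length (cube (suc n)) * f (x ∷ z)     ≡⟨ double (f (x ∷ z)) ⟩
  length (cube n) * (2 * f (x ∷ z))
    ≡⟨ ∑-cube-injective n r (λ v → 2 * f (x ∷ v)) (λ v → 2 * g (x ∷ v)) k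
         (λ i v → cong (2 *_) (tailPeriodic f pf i v))
         (λ i v → cong (2 *_) (tailPeriodic g pg i v)) tailEq z ⟩
  length (cube n) * (2 * g (x ∷ z)) + k ≡⟨ cong (_+ k) (double (g (x ∷ z))) ⟨
  length (cube (suc n)) * g (x ∷ z) + k ∎
  where
  open ≡-Reasoning
  q = 1 + r * 2
  double : ∀ a → length (cube (suc n)) * a ≡ length (cube n) * (2 * a)
  double a = trans (cong (_* a) (length-cube-suc n)) (l (length (cube n)) a)
    where
    l : ∀ c a → (c + c) * a ≡ c * (2 * a)
    l = solve-∀
  tailPeriodic : ∀ (f : Point (suc n) → ℕ) → Periodic q f → Periodic q (λ v → f (x ∷ v))
  tailPeriodic f pf i v = trans (cong (λ y → f (y ∷ (v ⊕ ((+ q) • unit i))))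
    (sym (trans (cong (ℤ._+_ x) (ℤₚ.*-zeroʳ (+ q))) (ℤₚ.+-identityʳ x)))) (pf (suc i) (x ∷ v))
  -- The index counts downwards from x because the cube extends in the direction -1, so adjacent
  -- entries add up to one cube sum.
  column : (Point (suc n) → ℕ) → Point n → ℕ → ℕ
  column f v j = ∑ (cube n) (λ c → f ((x ℤ.- + j) ∷ (v ⊕ c)))
  next : ∀ j → (x ℤ.- + j) ℤ.+ -1ℤ ≡ x ℤ.- + suc j
  next j = trans (ℤₚ.+-assoc x (ℤ.- + j) -1ℤ) (cong (ℤ._+_ x)
    (trans (sym (ℤₚ.neg-distrib-+ (+ j) 1ℤ)) (cong (λ w → ℤ.- (+ w)) (ℕₚ.+-comm j 1))))
  slice : ∀ f v j → (cube (suc n) ⋆ f) ((x ℤ.- + j) ∷ v) ≡ column f v j + column f v (suc j)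
  slice f v j = trans (∑-layers 0ℤ -1ℤ (cube n) (cube n) _)
    (cong₂ _+_ (∑-cong (cube n) λ c → cong (λ y → f (y ∷ (v ⊕ c))) (ℤₚ.+-identityʳ _))
                 (∑-cong (cube n) λ c → cong (λ y → f (y ∷ (v ⊕ c))) (next j)))
  columnPeriodic : ∀ f → Periodic q f → ∀ v → column f v q ≡ column f v 0
  columnPeriodic f pf v = ∑-cong (cube n) λ c → trans (sym (pf zero ((x ℤ.- + q) ∷ (v ⊕ c))))
    (cong f (cong₂ _∷_
      (trans (ℤₚ.+-assoc x (ℤ.- + q) _) (cong (ℤ._+_ x)
        (trans (cong (ℤ._+_ (ℤ.- + q)) (ℤₚ.*-identityʳ (+ q))) (ℤₚ.+-inverseˡ (+ q)))))
      (trans (cong ((v ⊕ c) ⊕_) (•0ᵥ (+ q))) (⊕-identityʳ _))))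
  base : ∀ f v → column f v 0 ≡ (cube n ⋆ (λ w → f (x ∷ w))) v
  base f v = ∑-cong (cube n) λ c → cong (λ y → f (y ∷ (v ⊕ c))) (ℤₚ.+-identityʳ x)
  twice : ∀ f v → (cube n ⋆ (λ w → 2 * f (x ∷ w))) v ≡ 2 * column f v 0
  twice f v = trans (∑-* (cube n) 2 _) (cong (2 *_) (sym (base f v)))
  tailEq : ∀ v → (cube n ⋆ (λ w → 2 * f (x ∷ w))) v ≡ (cube n ⋆ (λ w → 2 * g (x ∷ w))) v + k
  tailEq v = begin
    (cube n ⋆ (λ w → 2 * f (x ∷ w))) v ≡⟨ twice f v ⟩
    2 * column f v 0
      ≡⟨ odd-period⇒halve (column f v) (column g v) k
           (λ j → trans (sym (slice f v j)) (trans (eq _) (cong (_+ k) (slice g v j))))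
           r (columnPeriodic f pf v) (columnPeriodic g pg v) ⟩
    2 * column g v 0 + k ≡⟨ cong (_+ k) (twice g v) ⟨
    (cube n ⋆ (λ w → 2 * g (x ∷ w))) v + k ∎

-- Translation operators modulo p

module ModP {p} (pr : Prime p) (n : ℕ) where
  instance _ = prime⇒nonZero pr

  -- Functions keep natural values and only their equality is taken modulo p. The endomorphism
  -- semiring then has characteristic p, while exact counts of lattice points can be used in it
  -- directly.
  functions : CommutativeMonoid _ _
  functions = record
    { Carrier = Point n → ℕ
    ; _≈_ = λ f g → ∀ z → f z % p ≡ g z % p
    ; _∙_ = λ f g z → f z + g z
    ; ε = λ _ → 0
    ; isCommutativeMonoid = record
      { isMonoid = record
        { isSemigroup = record
          { isMagma = record
            { isEquivalence = record
              { refl = λ _ → refl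
              ; sym = λ e z → sym (e z)
              ; trans = λ d e z → trans (d z) (e z) }
            ; ∙-cong = λ d e z → %-cong-+ (d z) (e z) }
          ; assoc = λ f g h z → cong (_% p) (ℕₚ.+-assoc (f z) (g z) (h z)) }
        ; identity = (λ _ _ → refl) , (λ f z → cong (_% p) (ℕₚ.+-identityʳ (f z))) }
      ; comm = λ f g z → cong (_% p) (ℕₚ.+-comm (f z) (g z)) } }
    where
    %-cong-+ : ∀ {a b c d} → a % p ≡ b % p → c % p ≡ d % p → (a + c) % p ≡ (b + d) % p
    %-cong-+ {a} {b} {c} {d} e f = trans (%-distribˡ-+ a c p)
      (trans (cong₂ (λ x y → (x + y) % p) e f) (sym (%-distribˡ-+ b d p)))

  open CommutativeMonoid functions using (_≈_; ∙-cong) public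
  open Endo functions public
  open Semiring semiring using (+-cong; setoid) renaming (_≈_ to _≋_)
  open Frobenius semiring public
  open Mult semiring using () renaming (_×_ to _·×_)

  %-shift : ∀ {a b m} → p ∣ m → a ≡ m + b → a % p ≡ b % p
  %-shift {b = b} (divides k refl) refl = trans (cong (_% p) (ℕₚ.+-comm _ b)) ([m+kn]%n≡m%n b k p)

  char : ∀ A → p ·× A ≋ 0ᴱ
  char A f z = trans (cong (_% p) (trans (multiple p) (ℕₚ.*-comm p _)))
    (trans (m*n%n≡0 (app A f z) p) (sym (m*n%n≡0 0 p)))
    where
    multiple : ∀ k → app (k ·× A) f z ≡ k * app A f z
    multiple zero = refl
    multiple (suc k) = cong (_+_ (app A f z)) (multiple k)

  op : List (Point n) → End
  op L .app f = L ⋆ f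
  op [] .resp e z = refl
  op (v ∷ L) .resp {f} {g} e = ∙-cong {λ z → f (z ⊕ v)} {λ z → g (z ⊕ v)} {L ⋆ f} {L ⋆ g}
    (λ z → e (z ⊕ v)) (op L .resp {f} {g} e)
  op L .add f g z = cong (_% p) (∑-+ L (λ v → f (z ⊕ v)) (λ v → g (z ⊕ v)))
  op L .null z = cong (_% p) (trans (∑-const L 0) (ℕₚ.*-zeroʳ (length L)))

  op-comm : ∀ L M → op L ⊠ op M ≋ op M ⊠ op L
  op-comm L M f z = cong (_% p) (⋆-comm L M f z)

  op-∷ : ∀ v L → op (v ∷ L) ≋ op (v ∷ []) ⊞ op L
  op-∷ v L f z = cong (λ w → (w + (L ⋆ f) z) % p) (sym (ℕₚ.+-identityʳ _))

  shift-^ : ∀ v k → op (v ∷ []) ↑ k ≋ op (((+ k) • v) ∷ [])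
  shift-^ v zero f z = cong (_% p) (sym (trans (ℕₚ.+-identityʳ _)
    (cong f (trans (cong (z ⊕_) (0• v)) (⊕-identityʳ z)))))
  shift-^ v (suc k) f z = trans
    (op (v ∷ []) .resp {app (op (v ∷ []) ↑ k) f} {op (((+ k) • v) ∷ []) .app f} (shift-^ v k f) z)
    (cong (λ w → (w + 0) % p) (trans (ℕₚ.+-identityʳ _) (cong f (trans (⊕-assoc z v _)
      (cong (z ⊕_) (trans (cong (_⊕ ((+ k) • v)) (sym (1• v))) (sym (•-distribʳ 1ℤ (+ k) v))))))))

  -- A list of translations is a sum of commuting single translations, so Frobenius splits off one
  -- at a time, and the p-th power of a translation by v is the translation by p v.
  op-frobenius : ∀ L → op L ↑ p ≋ op (map ((+ p) •_) L)
  -- The empty list is the zero operator; its power is zero because p is positive, the power with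
  -- exponent 0 being the identity.
  op-frobenius [] = 0^ p
    where
    0^ : ∀ m → .{{ℕ.NonZero m}} → op [] ↑ m ≋ op []
    0^ (suc m) f z = refl
  op-frobenius (v ∷ L) = begin
    op (v ∷ L) ↑ p
      ≈⟨ ^-congˡ p {op (v ∷ L)} {op (v ∷ []) ⊞ op L} (op-∷ v L) ⟩
    (op (v ∷ []) ⊞ op L) ↑ p
      ≈⟨ frobenius pr char (op (v ∷ [])) (op L) (op-comm (v ∷ []) L) ⟩
    op (v ∷ []) ↑ p ⊞ op L ↑ p
      ≈⟨ +-cong {op (v ∷ []) ↑ p} {op (((+ p) • v) ∷ [])} {op L ↑ p} {op (map ((+ p) •_) L)}
           (shift-^ v p) (op-frobenius L) ⟩
    op (((+ p) • v) ∷ []) ⊞ op (map ((+ p) •_) L)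
      ≈⟨ op-∷ ((+ p) • v) (map ((+ p) •_) L) ⟨
    op (map ((+ p) •_) (v ∷ L)) ∎
    where open import Relation.Binary.Reasoning.Setoid setoid

  op-frobenius-iterated : ∀ k L → op L ↑ (p ^ k) ≋ op (map ((+ (p ^ k)) •_) L)
  op-frobenius-iterated zero L f z = cong (λ M → (M ⋆ f) z % p)
    (sym (trans (Listₚ.map-cong 1•_ L) (Listₚ.map-id L)))
  op-frobenius-iterated (suc k) L = begin
    op L ↑ (p * p ^ k)
      ≈⟨ ^-assocʳ (op L) p (p ^ k) ⟨
    (op L ↑ p) ↑ (p ^ k)
      ≈⟨ ^-congˡ (p ^ k) {op L ↑ p} {op (map ((+ p) •_) L)} (op-frobenius L) ⟩
    op (map ((+ p) •_) L) ↑ (p ^ k)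
      ≈⟨ op-frobenius-iterated k (map ((+ p) •_) L) ⟩
    op (map ((+ (p ^ k)) •_) (map ((+ p) •_) L))
      ≡⟨ cong op collapse ⟩
    op (map ((+ (p ^ suc k)) •_) L) ∎
    where
    open import Relation.Binary.Reasoning.Setoid setoid
    collapse : map ((+ (p ^ k)) •_) (map ((+ p) •_) L) ≡ map ((+ (p ^ suc k)) •_) L
    collapse = trans (sym (Listₚ.map-∘ L)) (Listₚ.map-cong (λ v →
      trans (sym (•-assoc (+ (p ^ k)) (+ p) v))
      (cong (_• v) (trans (sym (ℤₚ.pos-* (p ^ k) p)) (cong +_ (ℕₚ.*-comm (p ^ k) p))))) L)

-- Sums over the axes, vector identities and the final arithmetic

∈⇒≤∑ : ∀ {I : Set} {L : List I} f {x} → x ∈ L → f x ≤ ∑ L f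
∈⇒≤∑ f (here refl) = ℕₚ.m≤m+n _ _
∈⇒≤∑ f (there p) = ℕₚ.≤-trans (∈⇒≤∑ f p) (ℕₚ.m≤n+m _ _)

∑-*ʳ : ∀ {I : Set} (L : List I) f k → ∑ L (λ x → f x * k) ≡ ∑ L f * k
∑-*ʳ L f k = trans (∑-cong L λ x → ℕₚ.*-comm (f x) k) (trans (∑-* L k f) (ℕₚ.*-comm k _))

odd-^ : ∀ s L → ∃ λ r → (1 + s * 2) ^ L ≡ 1 + r * 2
odd-^ s zero = 0 , refl
odd-^ s (suc L) with r , e ← odd-^ s L = r + s * (1 + r * 2) , trans (cong ((1 + s * 2) *_) e) (l s r)
  where
  l : ∀ s r → (1 + s * 2) * (1 + r * 2) ≡ 1 + (r + s * (1 + r * 2)) * 2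
  l = solve-∀

axes : ∀ n → List (Point n)
axes n = map unit (allFin n) ++ map (⊖_ ∘ unit) (allFin n)

∑-axes : ∀ (f : Point n → ℕ) → ∑ (axes n) f ≡ ∑ (allFin n) (λ i → f (unit i) + f (⊖ unit i))
∑-axes {n} f = begin
  ∑ (axes n) f ≡⟨ ∑-++ (map unit (allFin n)) _ f ⟩
  ∑ (map unit (allFin n)) f + ∑ (map (⊖_ ∘ unit) (allFin n)) f
    ≡⟨ cong₂ _+_ (∑-map unit (allFin n) f) (∑-map (⊖_ ∘ unit) (allFin n) f) ⟩
  ∑ (allFin n) (f ∘ unit) + ∑ (allFin n) (λ i → f (⊖ unit i))
    ≡⟨ ∑-+ (allFin n) _ _ ⟨
  ∑ (allFin n) (λ i → f (unit i) + f (⊖ unit i)) ∎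
  where open ≡-Reasoning

∑-allFin-const : ∀ n k → ∑ (allFin n) (λ _ → k) ≡ n * k
∑-allFin-const n k = trans (∑-const (allFin n) k) (cong (_* k) (Listₚ.length-tabulate {n = n} (λ i → i)))

cube-neighbours-at : ∀ (f : Point n → ℕ) z i →
  ∑ (cube n) (λ c → f ((z ⊕ c) ⊕ unit i) + f ((z ⊕ c) ⊕ (⊖ unit i))) ≡ (cube n ⋆ f) z + (arm i ⋆ f) z
cube-neighbours-at {n} f z i = trans
  (∑-cong (cube n) λ c → cong₂ _+_ (cong f (⊕-assoc z c _)) (cong f (⊕-assoc z c _)))
  (∑-cube-neighbours i (λ x → f (z ⊕ x)))

-- Exchanging the sums treats one direction at a time; each of the n directions returns one copy of
-- the cube sum and its own arm.
cube⋆axes : ∀ (f : Point n → ℕ) z →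
  (cube n ⋆ (axes n ⋆ f)) z ≡ n * (cube n ⋆ f) z + ∑ (allFin n) (λ i → (arm i ⋆ f) z)
cube⋆axes {n} f z = begin
  (cube n ⋆ (axes n ⋆ f)) z
    ≡⟨ ∑-cong (cube n) (λ c → ∑-axes (λ v → f ((z ⊕ c) ⊕ v))) ⟩
  ∑ (cube n) (λ c → ∑ (allFin n) (λ i → f ((z ⊕ c) ⊕ unit i) + f ((z ⊕ c) ⊕ (⊖ unit i))))
    ≡⟨ ∑-swap (cube n) (allFin n) _ ⟩
  ∑ (allFin n) (λ i → ∑ (cube n) (λ c → f ((z ⊕ c) ⊕ unit i) + f ((z ⊕ c) ⊕ (⊖ unit i))))
    ≡⟨ ∑-cong (allFin n) (cube-neighbours-at f z) ⟩
  ∑ (allFin n) (λ i → (cube n ⋆ f) z + (arm i ⋆ f) z)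
    ≡⟨ ∑-+ (allFin n) _ _ ⟩
  ∑ (allFin n) (λ _ → (cube n ⋆ f) z) + ∑ (allFin n) (λ i → (arm i ⋆ f) z)
    ≡⟨ cong (_+ ∑ (allFin n) (λ i → (arm i ⋆ f) z)) (∑-allFin-const n _) ⟩
  n * (cube n ⋆ f) z + ∑ (allFin n) (λ i → (arm i ⋆ f) z) ∎
  where open ≡-Reasoning

[z⊕y]⊕[x⊖y] : ∀ (x y z : Point n) → (z ⊕ y) ⊕ (x ⊕ (⊖ y)) ≡ z ⊕ x
[z⊕y]⊕[x⊖y] [] [] [] = refl
[z⊕y]⊕[x⊖y] (a ∷ x) (b ∷ y) (c ∷ z) = cong₂ _∷_ (l a b c) ([z⊕y]⊕[x⊖y] x y z)
  where
  l : ∀ a b c → (c ℤ.+ b) ℤ.+ (a ℤ.+ -1ℤ ℤ.* b) ≡ c ℤ.+ a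
  l = ℤ-Solver.solve-∀

x⊖y⊕y⊖z : ∀ (x y z : Point n) → (x ⊕ (⊖ y)) ⊕ (y ⊕ (⊖ z)) ≡ x ⊕ (⊖ z)
x⊖y⊕y⊖z [] [] [] = refl
x⊖y⊕y⊖z (a ∷ x) (b ∷ y) (c ∷ z) = cong₂ _∷_ (l a b c) (x⊖y⊕y⊖z x y z)
  where
  l : ∀ a b c → (a ℤ.+ -1ℤ ℤ.* b) ℤ.+ (b ℤ.+ -1ℤ ℤ.* c) ≡ a ℤ.+ -1ℤ ℤ.* c
  l = ℤ-Solver.solve-∀

⊖[x⊖y] : ∀ (x y : Point n) → ⊖ (x ⊕ (⊖ y)) ≡ y ⊕ (⊖ x)
⊖[x⊖y] [] [] = refl
⊖[x⊖y] (a ∷ x) (b ∷ y) = cong₂ _∷_ (l a b) (⊖[x⊖y] x y)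
  where
  l : ∀ a b → -1ℤ ℤ.* (a ℤ.+ -1ℤ ℤ.* b) ≡ b ℤ.+ -1ℤ ℤ.* a
  l = ℤ-Solver.solve-∀

[z⊖v]⊕u : ∀ (z v u : Point n) → ⊖ ((⊖ (z ⊕ u)) ⊕ v) ≡ (z ⊕ (⊖ v)) ⊕ u
[z⊖v]⊕u [] [] [] = refl
[z⊖v]⊕u (a ∷ x) (b ∷ y) (c ∷ z) = cong₂ _∷_ (l a b c) ([z⊖v]⊕u x y z)
  where
  l : ∀ a b c → -1ℤ ℤ.* (-1ℤ ℤ.* (a ℤ.+ c) ℤ.+ b) ≡ (a ℤ.+ -1ℤ ℤ.* b) ℤ.+ c
  l = ℤ-Solver.solve-∀

⊖[x⊕u]⊕u : ∀ (x u : Point n) → (⊖ (x ⊕ u)) ⊕ u ≡ ⊖ x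
⊖[x⊕u]⊕u [] [] = refl
⊖[x⊕u]⊕u (a ∷ x) (b ∷ u) = cong₂ _∷_ (l a b) (⊖[x⊕u]⊕u x u)
  where
  l : ∀ a b → -1ℤ ℤ.* (a ℤ.+ b) ℤ.+ b ≡ -1ℤ ℤ.* a
  l = ℤ-Solver.solve-∀

-- This is (q - 1) z, written as a difference so that `Λ (drift q z)` is literally the congruence of
-- q z and z modulo Λ.
drift : ℤ → Point n → Point n
drift q z = (q • z) ⊕ (⊖ z)

drift-⊕ : ∀ q (x y : Point n) → drift q (x ⊕ y) ≡ drift q x ⊕ drift q y
drift-⊕ q [] [] = refl
drift-⊕ q (a ∷ x) (b ∷ y) = cong₂ _∷_ (l q a b) (drift-⊕ q x y)
  where
  l : ∀ q a b → q ℤ.* (a ℤ.+ b) ℤ.+ -1ℤ ℤ.* (a ℤ.+ b) ≡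
    (q ℤ.* a ℤ.+ -1ℤ ℤ.* a) ℤ.+ (q ℤ.* b ℤ.+ -1ℤ ℤ.* b)
  l = ℤ-Solver.solve-∀

drift-• : ∀ q k (x : Point n) → drift q (k • x) ≡ k • drift q x
drift-• q k [] = refl
drift-• q k (a ∷ x) = cong₂ _∷_ (l q k a) (drift-• q k x)
  where
  l : ∀ q k a → q ℤ.* (k ℤ.* a) ℤ.+ -1ℤ ℤ.* (k ℤ.* a) ≡ k ℤ.* (q ℤ.* a ℤ.+ -1ℤ ℤ.* a)
  l = ℤ-Solver.solve-∀

-- The first bound gives k′ ≤ k, so the second gives 2 s k ≤ 2 k and hence s ≤ 1. As 1 is not prime,
-- s = 1; then k ≤ k′ as well, so m = 2 k.
bounds⇒p≡3 : ∀ {m k k′} s → Prime (1 + s * 2) → 1 ≤ m → k + k′ ≡ m → m ≤ 2 * k → (s * 2) * k ≤ 2 * k′ →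
  s ≡ 1 × 2 ∣ m
bounds⇒p≡3 {k = zero} _ _ 1≤m _ m≤0 _ = contradiction (ℕₚ.≤-trans 1≤m m≤0) λ ()
bounds⇒p≡3 {m} {k@(suc _)} {k′} s pr _ k+k′≡m m≤2k le = go s pr s≤1 le
  where
  k′≤k : k′ ≤ k
  k′≤k = ℕₚ.+-cancelˡ-≤ k k′ k (subst₂ _≤_ (sym k+k′≡m) (cong (_+_ k) (ℕₚ.+-identityʳ k)) m≤2k)
  s≤1 : s ≤ 1
  s≤1 = ℕₚ.*-cancelʳ-≤ s 1 2 (ℕₚ.*-cancelʳ-≤ (s * 2) 2 k (ℕₚ.≤-trans le (ℕₚ.*-monoʳ-≤ 2 k′≤k)))
  go : ∀ s → Prime (1 + s * 2) → s ≤ 1 → (s * 2) * k ≤ 2 * k′ → s ≡ 1 × 2 ∣ m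
  go zero pr _ _ = contradiction pr ¬prime[1]
  go (suc zero) _ _ le = refl , divides k (begin
    m          ≡⟨ k+k′≡m ⟨
    k + k′     ≡⟨ cong (_+_ k) (ℕₚ.≤-antisym k′≤k (ℕₚ.*-cancelˡ-≤ 2 le)) ⟩
    k + k      ≡⟨ cong (_+_ k) (ℕₚ.+-identityʳ k) ⟨
    2 * k      ≡⟨ ℕₚ.*-comm 2 k ⟩
    k * 2 ∎)
    where open ≡-Reasoning
  go (suc (suc _)) _ (s≤s ()) _

-- Lattice tilings

-- `covered` and `disjoint` state the tiling condition in dual form: every translate z + Υₙ contains
-- exactly one point of Λ. Decidability makes the indicator function δ available.
record TilingLattice {n} (Λ : Point n → Set) : Set where
  field
    Λ? : ∀ z → Dec (Λ z)
    Λ-⊕ : ∀ {x y} → Λ x → Λ y → Λ (x ⊕ y)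
    Λ-• : ∀ k {x} → Λ x → Λ (k • x)
    covered : ∀ z → ∃ λ u → u ∈ tile n × Λ (z ⊕ u)
    disjoint : ∀ z {u v} → u ∈ tile n → v ∈ tile n → Λ (z ⊕ u) → Λ (z ⊕ v) → u ≡ v

  δ : Point n → ℕ
  δ z = 𝟙 (Λ? z)

  tile⋆δ : ∀ z → (tile n ⋆ δ) z ≡ 1
  tile⋆δ z with u , u∈ , Λu ← covered z =
    ∑𝟙≡1 (Λ? ∘ (z ⊕_)) (tile-unique n) u∈ Λu (λ v∈ Λv → disjoint z v∈ u∈ Λv Λu)

  ∑-tile-δ : ∀ z → ∑ (tile n) (λ u → δ (u ⊕ z)) ≡ 1
  ∑-tile-δ z = trans (∑-cong (tile n) λ u → cong δ (⊕-comm u z)) (tile⋆δ z)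

  partition : ∀ z → (cube n ⋆ δ) z + ∑ (allFin n) (λ i → (arm i ⋆ δ) z) ≡ 1
  partition z = trans (sym (∑-tile n (δ ∘ (z ⊕_)))) (tile⋆δ z)

  δ-⊖ : ∀ z → δ (⊖ z) ≡ δ z
  δ-⊖ z = 𝟙-cong _ _ (λ p → subst Λ (⊖-involutive z) (Λ-• -1ℤ p)) (Λ-• -1ℤ)

  Λ-0ᵥ : Λ 0ᵥ
  Λ-0ᵥ with _ , _ , p ← covered 0ᵥ = subst Λ (0• _) (Λ-• 0ℤ p)

  _~_ : Point n → Point n → Set
  x ~ y = Λ (x ⊕ (⊖ y))

  ~-sym : ∀ {x y} → x ~ y → y ~ x
  ~-sym {x} {y} p = subst Λ (⊖[x⊖y] x y) (Λ-• -1ℤ p)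

  δ-~ : ∀ z {x y} → x ~ y → δ (z ⊕ x) ≡ δ (z ⊕ y)
  δ-~ z {x} {y} p = 𝟙-cong _ _
    (λ a → subst Λ ([z⊕y]⊕[x⊖y] y x z) (Λ-⊕ a (~-sym p)))
    (λ a → subst Λ ([z⊕y]⊕[x⊖y] x y z) (Λ-⊕ a p))

  -- The subgroup H and the first inequality

  module _ (q : ℤ) where
    -- The indicator function of H = {z : (q - 1) z ∈ Λ}, a subgroup containing Λ.
    η : Point n → ℕ
    η z = 𝟙 (Λ? (drift q z))

    η-absorb : ∀ z {w} → Λ (drift q w) → η (z ⊕ w) ≡ η z
    η-absorb z {w} p = 𝟙-cong _ _
      (λ a → subst Λ (trans (cong (_⊕ (⊖ drift q w)) (drift-⊕ q z w)) (x⊕y⊖y (drift q z) (drift q w)))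
        (Λ-⊕ a (Λ-• -1ℤ p)))
      (λ a → subst Λ (sym (drift-⊕ q z w)) (Λ-⊕ a p))

    η-0ᵥ : η 0ᵥ ≡ 1
    η-0ᵥ with Λ? (drift q 0ᵥ)
    ... | yes _ = refl
    ... | no ¬p = contradiction
      (subst Λ (sym (trans (cong₂ _⊕_ (•0ᵥ q) (•0ᵥ -1ℤ)) (⊕-identityˡ 0ᵥ))) Λ-0ᵥ) ¬p

    η-⊖ : ∀ z → η (⊖ z) ≡ η z
    η-⊖ z = trans (cong δ (drift-• q -1ℤ z)) (δ-⊖ (drift q z))

    η-~ : ∀ {x y} → x ~ y → η x ≡ η y
    η-~ {x} {y} p = trans
      (cong η (sym (trans (⊕-comm y _) (trans (⊕-assoc x _ y)
        (trans (cong (x ⊕_) (trans (⊕-comm _ y) (⊕-inverseʳ y))) (⊕-identityʳ x))))))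
      (η-absorb y (Λ-⊕ (Λ-• q p) (Λ-• -1ℤ p)))

    -- Double counting: η is a sum of translates of δ, one for each v in the tile with η v = 1.
    tile⋆η : ∀ z → (tile n ⋆ η) z ≡ ∑ (tile n) η
    tile⋆η z = begin
      ∑ (tile n) (λ u → η (z ⊕ u))
        ≡⟨ ∑-cong (tile n) decompose ⟩
      ∑ (tile n) (λ u → ∑ (tile n) (λ v → η v * δ ((z ⊕ (⊖ v)) ⊕ u)))
        ≡⟨ ∑-swap (tile n) (tile n) _ ⟩
      ∑ (tile n) (λ v → ∑ (tile n) (λ u → η v * δ ((z ⊕ (⊖ v)) ⊕ u)))
        ≡⟨ ∑-cong (tile n) (λ v → trans (∑-* (tile n) (η v) _)
             (trans (cong (η v *_) (tile⋆δ _)) (ℕₚ.*-identityʳ _))) ⟩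
      ∑ (tile n) η ∎
      where
      open ≡-Reasoning
      -- Where the factor δ is 1, the points z + u and v are congruent modulo Λ, and η takes the
      -- same value on both.
      replace : ∀ u v → η (z ⊕ u) * δ ((z ⊕ (⊖ v)) ⊕ u) ≡ η v * δ ((z ⊕ (⊖ v)) ⊕ u)
      replace u v with Λ? ((z ⊕ (⊖ v)) ⊕ u)
      ... | yes p = cong (_* 1) (η-~ (subst Λ
        (trans (⊕-assoc z _ u) (trans (cong (z ⊕_) (⊕-comm _ u)) (sym (⊕-assoc z u _)))) p))
      ... | no _  = trans (ℕₚ.*-zeroʳ (η (z ⊕ u))) (sym (ℕₚ.*-zeroʳ (η v)))
      -- Multiplies by 1 = Σ δ(v - (z + u)) over v in the tile, which selects the representative v
      -- of z + u, and then uses that δ is even.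
      decompose : ∀ u → η (z ⊕ u) ≡ ∑ (tile n) (λ v → η v * δ ((z ⊕ (⊖ v)) ⊕ u))
      decompose u = begin
        η (z ⊕ u)                                             ≡⟨ ℕₚ.*-identityʳ _ ⟨
        η (z ⊕ u) * 1                                       ≡⟨ cong (η (z ⊕ u) *_) (tile⋆δ (⊖ (z ⊕ u))) ⟨
        η (z ⊕ u) * ∑ (tile n) (λ v → δ ((⊖ (z ⊕ u)) ⊕ v))  ≡⟨ ∑-* (tile n) (η (z ⊕ u)) _ ⟨
        ∑ (tile n) (λ v → η (z ⊕ u) * δ ((⊖ (z ⊕ u)) ⊕ v))
          ≡⟨ ∑-cong (tile n) (λ v → trans
               (cong (η (z ⊕ u) *_) (trans (sym (δ-⊖ _)) (cong δ ([z⊖v]⊕u z v u)))) (replace u v)) ⟩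
        ∑ (tile n) (λ v → η v * δ ((z ⊕ (⊖ v)) ⊕ u)) ∎

  -- `idem` puts every q eᵢ into H, so η has the odd period q and P can be cancelled from P (η + S
  -- η) = P (n η) + c. Here c counts the points of H in the tile, among them the origin, so c > 0;
  -- evaluating at the origin yields the strict inequality n < 1 + 2k.
  n≤2∑η : ∀ r → let q = + (1 + r * 2) in (∀ i → Λ (drift q (q • unit i))) →
    n ≤ 2 * ∑ (allFin n) (λ i → η q (unit i))
  n≤2∑η r idem = ℕₚ.≤-pred (ℕₚ.*-cancelˡ-< (length (cube n)) _ _ (begin-strict
    length (cube n) * n
      ≡⟨ cong (length (cube n) *_) (trans (cong (n *_) (η-0ᵥ q)) (ℕₚ.*-identityʳ n)) ⟨
    length (cube n) * (n * η q 0ᵥ)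
      <⟨ ℕₚ.m<m+n _ ∑η>0 ⟩
    length (cube n) * (n * η q 0ᵥ) + ∑ (tile n) (η q)
      ≡⟨ ∑-cube-injective n r (λ z → η q z + (axes n ⋆ η q) z) (λ z → n * η q z) _
           (λ i z → cong₂ _+_ (period i z) (∑-cong (axes n) λ v →
             trans (cong (η q) (swapʳ z _ v)) (period i (z ⊕ v))))
           (λ i z → cong (n *_) (period i z)) cube-eq 0ᵥ ⟨
    length (cube n) * (η q 0ᵥ + (axes n ⋆ η q) 0ᵥ)
      ≡⟨ cong (length (cube n) *_) (cong₂ _+_ (η-0ᵥ q) at-0ᵥ) ⟩
    length (cube n) * suc (2 * ∑ (allFin n) (λ i → η q (unit i))) ∎))
    where
    open ℕₚ.≤-Reasoning
    q = + (1 + r * 2)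
    period : Periodic (1 + r * 2) (η q)
    period i z = η-absorb q z (idem i)
    swapʳ : ∀ (x y z : Point n) → (x ⊕ y) ⊕ z ≡ (x ⊕ z) ⊕ y
    swapʳ x y z = trans (⊕-assoc x y z) (trans (cong (x ⊕_) (⊕-comm y z)) (sym (⊕-assoc x z y)))
    ∑η>0 : 0 < ∑ (tile n) (η q)
    ∑η>0 = subst (_≤ ∑ (tile n) (η q)) (η-0ᵥ q) (∈⇒≤∑ (η q) (cube⊆tile (0ᵥ∈cube n)))
    cube-eq : ∀ z → (cube n ⋆ (λ z → η q z + (axes n ⋆ η q) z)) z
                  ≡ (cube n ⋆ (λ z → n * η q z)) z + ∑ (tile n) (η q)
    cube-eq z = begin-equality
      (cube n ⋆ (λ z → η q z + (axes n ⋆ η q) z)) z ≡⟨ ∑-+ (cube n) _ _ ⟩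
      P + (cube n ⋆ (axes n ⋆ η q)) z ≡⟨ cong (_+_ P) (cube⋆axes (η q) z) ⟩
      P + (n * P + R)                 ≡⟨ l P (n * P) R ⟩
      n * P + (P + R)                 ≡⟨ cong (_+_ (n * P)) (trans (sym (∑-tile n _)) (tile⋆η q z)) ⟩
      n * P + ∑ (tile n) (η q)        ≡⟨ cong (_+ _) (∑-* (cube n) n _) ⟨
      (cube n ⋆ (λ z → n * η q z)) z + ∑ (tile n) (η q) ∎
      where
      P = (cube n ⋆ η q) z
      R = ∑ (allFin n) (λ i → (arm i ⋆ η q) z)
      l : ∀ a b c → a + (b + c) ≡ b + (a + c)
      l = solve-∀
    at-0ᵥ : (axes n ⋆ η q) 0ᵥ ≡ 2 * ∑ (allFin n) (λ i → η q (unit i))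
    at-0ᵥ = begin-equality
      (axes n ⋆ η q) 0ᵥ ≡⟨ ∑-cong (axes n) (λ v → cong (η q) (⊕-identityˡ v)) ⟩
      ∑ (axes n) (η q)  ≡⟨ ∑-axes (η q) ⟩
      ∑ (allFin n) (λ i → η q (unit i) + η q (⊖ unit i))
        ≡⟨ ∑-cong (allFin n) (λ i → cong (_+_ (η q (unit i)))
             (trans (η-⊖ q _) (sym (ℕₚ.+-identityʳ _)))) ⟩
      ∑ (allFin n) (λ i → 2 * η q (unit i)) ≡⟨ ∑-* (allFin n) 2 _ ⟩
      2 * ∑ (allFin n) (λ i → η q (unit i)) ∎

  -- Encodes Q = 2 + S, the origin being listed twice for the summand 2. Being a list of
  -- translations, it is open to `op-frobenius`.
  stencil : List (Point n)
  stencil = 0ᵥ ∷ 0ᵥ ∷ axes n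

  -- Divisibility by p and the second inequality

  module _ {p} (pr : Prime p) (p∣1+n : p ∣ suc n) where
    open ModP pr n
    private instance p≢0 = prime⇒nonZero pr
    open CommutativeMonoid functions using (setoid) renaming (trans to ≈-trans)

    -- P S δ contributes n P δ and the arms. One further P δ completes the arms to the tile, whose
    -- sum is 1; the remaining (n + 1) P δ vanishes modulo p.
    cube⋆stencil⋆δ : cube n ⋆ (stencil ⋆ δ) ≈ (λ _ → 1)
    cube⋆stencil⋆δ z = %-shift (∣m⇒∣m*n ((cube n ⋆ δ) z) p∣1+n) (begin
      (cube n ⋆ (stencil ⋆ δ)) z
        ≡⟨ ∑-cong (cube n) (λ c → cong₂ (λ a b → δ a + (δ b + (axes n ⋆ δ) (z ⊕ c)))
             (⊕-identityʳ _) (⊕-identityʳ _)) ⟩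
      ∑ (cube n) (λ c → δ (z ⊕ c) + (δ (z ⊕ c) + (axes n ⋆ δ) (z ⊕ c)))
        ≡⟨ trans (∑-+ (cube n) _ _) (cong (_+_ P) (∑-+ (cube n) _ _)) ⟩
      P + (P + (cube n ⋆ (axes n ⋆ δ)) z)  ≡⟨ cong (λ w → P + (P + w)) (cube⋆axes δ z) ⟩
      P + (P + (n * P + R))            ≡⟨ l P n R ⟩
      suc n * P + (P + R)                ≡⟨ cong (_+_ (suc n * P)) (partition z) ⟩
      suc n * P + 1 ∎)
      where
      open ≡-Reasoning
      P = (cube n ⋆ δ) z
      R = ∑ (allFin n) (λ i → (arm i ⋆ δ) z)
      l : ∀ c n r → c + (c + (n * c + r)) ≡ suc n * c + (c + r)
      l = solve-∀

    -- The stencil has 2(n + 1) entries.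
    stencil⋆1 : stencil ⋆ (λ _ → 1) ≈ (λ _ → 0)
    stencil⋆1 z = %-shift {b = 0} (∣m⇒∣m*n 2 p∣1+n) (begin
      2 + ∑ (axes n) (λ _ → 1)   ≡⟨ cong (_+_ 2) (∑-axes {n} (λ _ → 1)) ⟩
      2 + ∑ (allFin n) (λ _ → 2) ≡⟨ cong (_+_ 2) (∑-allFin-const n 2) ⟩
      suc n * 2                  ≡⟨ ℕₚ.+-identityʳ _ ⟨
      suc n * 2 + 0 ∎)
      where open ≡-Reasoning

    -- P commutes with Q, so the first factor Q turns P δ into 1, the second turns 1 into 0, and all
    -- further factors preserve 0. This is why the exponent starts at 2.
    cube⋆stencil^ : ∀ k → cube n ⋆ app (op stencil ↑ (2 + k)) δ ≈ (λ _ → 0)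
    cube⋆stencil^ zero z = trans (cong (_% p) (⋆-comm (cube n) stencil (stencil ⋆ δ) z))
      (≈-trans {stencil ⋆ (cube n ⋆ (stencil ⋆ δ))} {stencil ⋆ (λ _ → 1)} {λ _ → 0}
        (op stencil .resp {cube n ⋆ (stencil ⋆ δ)} {λ _ → 1} cube⋆stencil⋆δ) stencil⋆1 z)
    cube⋆stencil^ (suc k) z = trans (cong (_% p) (⋆-comm (cube n) stencil g z))
      (≈-trans {stencil ⋆ (cube n ⋆ g)} {stencil ⋆ (λ _ → 0)} {λ _ → 0}
        (op stencil .resp {cube n ⋆ g} {λ _ → 0} (cube⋆stencil^ k)) (op stencil .null) z)
      where g = app (op stencil ↑ (2 + k)) δ

    -- Frobenius identifies the scaled stencil with Q^q modulo p, and q = p^L is at least 2 because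
    -- L is positive.
    p∣cube⋆scaled-stencil : ∀ {L} → 1 ≤ L → ∀ z → p ∣ (cube n ⋆ (map ((+ (p ^ L)) •_) stencil ⋆ δ)) z
    p∣cube⋆scaled-stencil {L} 1≤L z = m%n≡0⇒n∣m _ p (begin
      (cube n ⋆ (map ((+ q) •_) stencil ⋆ δ)) z % p
        ≡⟨ op (cube n) .resp {map ((+ q) •_) stencil ⋆ δ} {app (op stencil ↑ q) δ}
             (λ w → sym (op-frobenius-iterated L stencil δ w)) z ⟩
      (cube n ⋆ app (op stencil ↑ q) δ) z % p
        ≡⟨ cong (λ m → (cube n ⋆ app (op stencil ↑ m) δ) z % p) (ℕₚ.m+[n∸m]≡n 2≤q) ⟨
      (cube n ⋆ app (op stencil ↑ (2 + (q ∸ 2))) δ) z % p ≡⟨ cube⋆stencil^ (q ∸ 2) z ⟩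
      0 % p ≡⟨ m*n%n≡0 0 p ⟩
      0 ∎)
      where
      open ≡-Reasoning
      q = p ^ L
      2≤q : 2 ≤ q
      2≤q = ℕₚ.≤-trans (subst (2 ≤_) (sym (ℕₚ.^-identityʳ p))
          (ℕ.nonTrivial⇒n>1 p {{prime⇒nonTrivial pr}}))
        (ℕₚ.^-monoʳ-≤ p 1≤L)

    module Count {L} (1≤L : 1 ≤ L) where
      q = + (p ^ L)

      -- Equals 1 when eᵢ lies in H and 0 otherwise, so its sum is the k of the introduction.
      κ : Fin n → ℕ
      κ i = η q (unit i)

      P : Point n → ℕ
      P = cube n ⋆ δ

      pair : Fin n → Point n → ℕ
      pair i z = δ (z ⊕ (q • unit i)) + δ (z ⊕ (q • (⊖ unit i)))

      A B : Fin n → Point n → ℕ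
      A i = arm i ⋆ δ
      B i = cube n ⋆ pair i

      -- α collects the arms in the directions of H, β the far cubes, shifted by ± q eᵢ, in all
      -- other directions.
      α β : Point n → ℕ
      α z = ∑ (allFin n) (λ i → κ i * A i z)
      β z = ∑ (allFin n) (λ i → (1 ∸ κ i) * B i z)

      -- If eᵢ lies in H, then q eᵢ is congruent to eᵢ modulo Λ, so the far cubes count the same as
      -- the adjacent ones, that is, as the cube and the arm. Otherwise the whole term is left to β.
      B-split : ∀ z i → B i z ≡ κ i * P z + (κ i * A i z + (1 ∸ κ i) * B i z)
      B-split z i with Λ? (drift q (unit i))
      ... | no _  = sym (ℕₚ.+-identityʳ _)
      ... | yes p = trans
        (∑-cong (cube n) λ c → cong₂ _+_ (δ-~ (z ⊕ c) p)
          (δ-~ (z ⊕ c) (subst Λ (sym (drift-• q -1ℤ (unit i))) (Λ-• -1ℤ p))))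
        (trans (cube-neighbours-at δ z i) (l (P z) (A i z)))
        where
        l : ∀ c a → c + a ≡ 1 * c + (1 * a + 0)
        l = solve-∀

      total : ∀ z → (cube n ⋆ (map (q •_) stencil ⋆ δ)) z ≡ (2 + ∑ (allFin n) κ) * P z + (α z + β z)
      total z = begin
        (cube n ⋆ (map (q •_) stencil ⋆ δ)) z
          ≡⟨ ∑-cong (cube n) (λ c → cong₂ (λ a b → a + (a + b))
               (cong δ (trans (cong ((z ⊕ c) ⊕_) (•0ᵥ q)) (⊕-identityʳ _)))
               (trans (∑-map (q •_) (axes n) _) (∑-axes (λ v → δ ((z ⊕ c) ⊕ (q • v)))))) ⟩
        ∑ (cube n) (λ c → δ (z ⊕ c) + (δ (z ⊕ c) + ∑ (allFin n) (λ i → pair i (z ⊕ c))))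
          ≡⟨ trans (∑-+ (cube n) _ _) (cong (_+_ (P z)) (∑-+ (cube n) _ _)) ⟩
        P z + (P z + ∑ (cube n) (λ c → ∑ (allFin n) (λ i → pair i (z ⊕ c))))
          ≡⟨ cong (λ w → P z + (P z + w))
               (trans (∑-swap (cube n) (allFin n) _) (∑-cong (allFin n) (B-split z))) ⟩
        P z + (P z + ∑ (allFin n) (λ i → κ i * P z + (κ i * A i z + (1 ∸ κ i) * B i z)))
          ≡⟨ cong (λ w → P z + (P z + w))
               (trans (∑-+ (allFin n) _ _) (cong₂ _+_ ∑κC (∑-+ (allFin n) _ _))) ⟩
        P z + (P z + (∑ (allFin n) κ * P z + (α z + β z)))
          ≡⟨ l (P z) (∑ (allFin n) κ) (α z + β z) ⟩
        (2 + ∑ (allFin n) κ) * P z + (α z + β z) ∎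
        where
        open ≡-Reasoning
        ∑κC : ∑ (allFin n) (λ i → κ i * P z) ≡ ∑ (allFin n) κ * P z
        ∑κC = ∑-*ʳ (allFin n) κ (P z)
        l : ∀ c k r → c + (c + (k * c + r)) ≡ (2 + k) * c + r
        l = solve-∀

      κ≤1 : ∀ i → κ i ≤ 1
      κ≤1 i with Λ? (drift q (unit i))
      ... | yes _ = s≤s z≤n
      ... | no _  = z≤n

      -- A cell in an arm of index i with κ i = 1 lies in no cube, so divisibility by p forces
      -- p − 1 further contributions there.
      α≤β : ∀ z → (p ∸ 1) * α z ≤ β z
      α≤β z = go (P z) (∑ (allFin n) (λ i → A i z)) (α z) (partition z)
        (∑-mono (allFin n) λ i →
          subst (κ i * A i z ≤_) (ℕₚ.*-identityˡ _) (ℕₚ.*-monoˡ-≤ (A i z) (κ≤1 i)))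
        (subst (p ∣_) (total z) (p∣cube⋆scaled-stencil 1≤L z))
        where
        -- Since c + r = 1 and a ≤ r, a positive a forces c = 0 and a = 1. Then p divides 1 + β z,
        -- so β z is at least p - 1.
        go : ∀ c r a → c + r ≡ 1 → a ≤ r → p ∣ (2 + ∑ (allFin n) κ) * c + (a + β z) → (p ∸ 1) * a ≤ β z
        go c r zero _ _ _ = subst (_≤ β z) (sym (ℕₚ.*-zeroʳ (p ∸ 1))) z≤n
        go zero .1 (suc zero) refl _ d = subst (_≤ β z) (sym (ℕₚ.*-identityʳ (p ∸ 1)))
          (ℕₚ.∸-monoˡ-≤ 1 (∣⇒≤ (subst (λ w → p ∣ w + suc (β z)) (ℕₚ.*-zeroʳ (∑ (allFin n) κ)) d)))
        go zero .1 (suc (suc _)) refl (s≤s ()) _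
        go (suc zero) zero (suc _) _ () _
        go (suc zero) (suc _) _ () _ _
        go (suc (suc _)) _ _ () _ _

      -- Every translate of δ has sum 1 over the tile, so only the cells of the arm are counted.
      ∑A : ∀ i → ∑ (tile n) (A i) ≡ length (cube n)
      ∑A i = begin
        ∑ (tile n) (A i)      ≡⟨ ∑-swap (tile n) (arm i) (λ z a → δ (z ⊕ a)) ⟩
        ∑ (arm i) (λ a → ∑ (tile n) (λ z → δ (z ⊕ a))) ≡⟨ ∑-cong (arm i) ∑-tile-δ ⟩
        ∑ (arm i) (λ _ → 1)   ≡⟨ trans (∑-const (arm i) 1) (ℕₚ.*-identityʳ _) ⟩
        length (arm i)        ≡⟨ length-arm i ⟩
        length (cube n) ∎
        where open ≡-Reasoning

      ∑B : ∀ i → ∑ (tile n) (B i) ≡ length (cube n) * 2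
      ∑B i = begin
        ∑ (tile n) (B i)  ≡⟨ ∑-swap (tile n) (cube n) _ ⟩
        ∑ (cube n) (λ c → ∑ (tile n) (λ z → δ ((z ⊕ c) ⊕ (q • unit i)) + δ ((z ⊕ c) ⊕ (q • (⊖ unit i)))))
          ≡⟨ ∑-cong (cube n) (λ c → trans (∑-+ (tile n) _ _) (cong₂ _+_ (one c _) (one c _))) ⟩
        ∑ (cube n) (λ _ → 2) ≡⟨ ∑-const (cube n) 2 ⟩
        length (cube n) * 2 ∎
        where
        open ≡-Reasoning
        one : ∀ c v → ∑ (tile n) (λ z → δ ((z ⊕ c) ⊕ v)) ≡ 1
        one c v = trans (∑-cong (tile n) λ z → cong δ (⊕-assoc z c v)) (∑-tile-δ (c ⊕ v))

      -- Summing `α≤β` over the tile counts each direction in H with weight 2ⁿ and each other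
      -- direction, having two far cubes, with weight 2 · 2ⁿ; the common factor 2ⁿ cancels.
      [p-1]∑κ≤2∑[1-κ] : (p ∸ 1) * ∑ (allFin n) κ ≤ 2 * ∑ (allFin n) (λ i → 1 ∸ κ i)
      [p-1]∑κ≤2∑[1-κ] = ℕₚ.*-cancelˡ-≤ (length (cube n)) {{ℕ.>-nonZero (∈-length (0ᵥ∈cube n))}} (begin
        len * ((p ∸ 1) * ∑ (allFin n) κ)              ≡⟨ l len (p ∸ 1) (∑ (allFin n) κ) ⟩
        (p ∸ 1) * (∑ (allFin n) κ * len)              ≡⟨ cong ((p ∸ 1) *_) (weighted κ A len ∑A) ⟨
        (p ∸ 1) * ∑ (tile n) α                          ≡⟨ ∑-* (tile n) (p ∸ 1) α ⟨
        ∑ (tile n) (λ z → (p ∸ 1) * α z)                ≤⟨ ∑-mono (tile n) α≤β ⟩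
        ∑ (tile n) β                                      ≡⟨ weighted (λ i → 1 ∸ κ i) B _ ∑B ⟩
        ∑ (allFin n) (λ i → 1 ∸ κ i) * (len * 2)      ≡⟨ l′ len (∑ (allFin n) (λ i → 1 ∸ κ i)) ⟩
        len * (2 * ∑ (allFin n) (λ i → 1 ∸ κ i)) ∎)
        where
        open ℕₚ.≤-Reasoning
        len = length (cube n)
        l : ∀ a b c → a * (b * c) ≡ b * (c * a)
        l = solve-∀
        l′ : ∀ a b → b * (a * 2) ≡ a * (2 * b)
        l′ = solve-∀
        weighted : ∀ w (f : Fin n → Point n → ℕ) k → (∀ i → ∑ (tile n) (f i) ≡ k) →
          ∑ (tile n) (λ z → ∑ (allFin n) (λ i → w i * f i z)) ≡ ∑ (allFin n) w * k
        weighted w f k e = trans (∑-swap (tile n) (allFin n) _)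
          (trans (∑-cong (allFin n) λ i → trans (∑-* (tile n) (w i) (f i)) (cong (w i *_) (e i)))
                 (∑-*ʳ (allFin n) w k))

      ∑κ+∑[1-κ] : ∑ (allFin n) κ + ∑ (allFin n) (λ i → 1 ∸ κ i) ≡ n
      ∑κ+∑[1-κ] = trans (sym (∑-+ (allFin n) _ _)) (trans (∑-cong (allFin n) λ i → ℕₚ.m+[n∸m]≡n (κ≤1 i))
        (trans (∑-allFin-const n 1) (ℕₚ.*-identityʳ n)))

  -- Powers of p modulo Λ

  ~-refl : ∀ {x} → x ~ x
  ~-refl {x} = subst Λ (sym (⊕-inverseʳ x)) Λ-0ᵥ

  ~-trans : ∀ {x y z} → x ~ y → y ~ z → x ~ z
  ~-trans {x} {y} {z} p q = subst Λ (x⊖y⊕y⊖z x y z) (Λ-⊕ p q)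

  ~-• : ∀ k {x y} → x ~ y → (k • x) ~ (k • y)
  ~-• k {x} {y} p = subst Λ (trans (•-distribˡ k x (⊖ y)) (cong ((k • x) ⊕_)
    (trans (sym (•-assoc k -1ℤ y)) (trans (cong (_• y) (ℤₚ.*-comm k -1ℤ)) (•-assoc -1ℤ k y))))) (Λ-• k p)

  -- The position in the tile of the u with z + u in Λ. It determines z modulo Λ, so the quotient by
  -- Λ is finite.
  residue : Point n → Fin (length (tile n))
  residue z = index (proj₁ (proj₂ (covered z)))

  residue-injective : ∀ x y → residue x ≡ residue y → x ~ y
  residue-injective x y e with covered x | covered y
  ... | u , u∈ , p | v , v∈ , p′ =
    subst Λ (x⊕u⊖[y⊕u] x y v) (Λ-⊕ (subst (λ w → Λ (x ⊕ w)) u≡v p) (Λ-• -1ℤ p′))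
    where
    u≡v : u ≡ v
    u≡v = trans (lookup-index u∈) (trans (cong (List.lookup (tile n)) e) (sym (lookup-index v∈)))
    x⊕u⊖[y⊕u] : ∀ {n} (x y u : Point n) → (x ⊕ u) ⊕ (⊖ (y ⊕ u)) ≡ x ⊕ (⊖ y)
    x⊕u⊖[y⊕u] [] [] [] = refl
    x⊕u⊖[y⊕u] (a ∷ x) (b ∷ y) (c ∷ u) = cong₂ _∷_ (l a b c) (x⊕u⊖[y⊕u] x y u)
      where
      l : ∀ a b c → (a ℤ.+ c) ℤ.+ -1ℤ ℤ.* (b ℤ.+ c) ≡ a ℤ.+ -1ℤ ℤ.* b
      l = ℤ-Solver.solve-∀

  -- The pigeonhole principle is applied to the whole vector of residues of p^j eᵢ, so that one pair
  -- of exponents a < b gives p^a eᵢ congruent to p^b eᵢ for all i at once. From a onwards the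
  -- powers then have period b - a.
  idempotent-power : ∀ p → ∃ λ L → 1 ≤ L × ∀ i → let q = + (p ^ L) in Λ (drift q (q • unit i))
  idempotent-power p
    with a , b , a<b , e ← pigeonhole (ℕₚ.n<1+n _) (λ (j : Fin (suc (length (tile n) ^ n))) →
           funToFin (λ i → residue ((+ (p ^ toℕ j)) • unit i)))
    with d , a+d ← ℕₚ.m≤n⇒∃[o]m+o≡n a<b = L , s≤s z≤n , λ i →
      subst (_~ ((+ q) • unit i)) (collapse i) (~-sym (subst₂ (λ k l → pow k i ~ pow l i)
        (l₁ (toℕ a) d) (l₂ (toℕ a) d) (jump i (suc (toℕ a)) (suc d + toℕ a * d))))
    where
    -- Here `suc d` is b - a, so L is a multiple of the period that exceeds a. Hence L and 2L are
    -- whole periods apart within the periodic range, and q² eᵢ is congruent to q eᵢ.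
    L = suc (toℕ a) * suc d
    q = p ^ L
    pow : ℕ → Fin n → Point n
    pow k i = (+ (p ^ k)) • unit i
    collapse : ∀ i → pow (L + L) i ≡ (+ q) • ((+ q) • unit i)
    collapse i = trans (cong (_• unit i) (trans (cong +_ (ℕₚ.^-distribˡ-+-* p L L)) (ℤₚ.pos-* q q)))
      (•-assoc (+ q) (+ q) (unit i))
    l₁ : ∀ a d → a + (suc d + a * d) ≡ suc a * suc d
    l₁ = solve-∀
    l₂ : ∀ a d → a + (suc d + a * d) + suc a * suc d ≡ suc a * suc d + suc a * suc d
    l₂ = solve-∀
    shift : ∀ k c i → (+ (p ^ c)) • pow k i ≡ pow (k + c) i
    shift k c i = trans (sym (•-assoc (+ (p ^ c)) (+ (p ^ k)) (unit i))) (cong (_• unit i)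
      (trans (sym (ℤₚ.pos-* (p ^ c) (p ^ k)))
        (cong +_ (trans (ℕₚ.*-comm _ (p ^ k)) (sym (ℕₚ.^-distribˡ-+-* p k c))))))
    base : ∀ i → pow (toℕ a) i ~ pow (toℕ a + suc d) i
    base i = subst (λ k → pow (toℕ a) i ~ pow k i) (trans (sym a+d) (sym (ℕₚ.+-suc (toℕ a) d)))
      (residue-injective _ _ (trans (sym (finToFun-funToFin _ i))
        (trans (cong (λ w → finToFun w i) e) (finToFun-funToFin _ i))))
    jump : ∀ i m c → pow (toℕ a + c) i ~ pow (toℕ a + c + m * suc d) i
    jump i zero c = subst (λ k → pow (toℕ a + c) i ~ pow k i) (sym (ℕₚ.+-identityʳ (toℕ a + c))) ~-refl
    jump i (suc m) c = ~-trans
      (subst₂ _~_ (shift (toℕ a) c i)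
          (trans (shift (toℕ a + suc d) c i) (cong (λ k → pow k i) (l₃ (toℕ a) (suc d) c)))
        (~-• (+ (p ^ c)) (base i)))
      (subst (λ k → pow (toℕ a + (c + suc d)) i ~ pow k i) (l₄ (toℕ a) (suc d) c m)
        (jump i m (c + suc d)))
      where
      l₃ : ∀ a d c → a + d + c ≡ a + (c + d)
      l₃ = solve-∀
      l₄ : ∀ a d c m → a + (c + d) + m * d ≡ a + c + (d + m * d)
      l₄ = solve-∀

  odd-prime-bounds : ∀ {p} → Prime p → p ∣ suc n → ∀ s → p ≡ 1 + s * 2 →
    ∃ λ k → ∃ λ k′ → k + k′ ≡ n × n ≤ 2 * k × (p ∸ 1) * k ≤ 2 * k′
  odd-prime-bounds {p} pr p∣1+n s p≡ = bounds (idempotent-power p)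
    where
    n≤2∑κ : ∀ {q} r → q ≡ 1 + r * 2 → (∀ i → Λ (drift (+ q) ((+ q) • unit i))) →
      n ≤ 2 * ∑ (allFin n) (λ i → η (+ q) (unit i))
    n≤2∑κ r refl idem = n≤2∑η r idem
    q-odd : ∀ L → ∃ λ r → p ^ L ≡ 1 + r * 2
    q-odd L = subst (λ p → ∃ λ r → p ^ L ≡ 1 + r * 2) (sym p≡) (odd-^ s L)
    bounds : (∃ λ L → 1 ≤ L × ∀ i → let q = + (p ^ L) in Λ (drift q (q • unit i))) →
      ∃ λ k → ∃ λ k′ → k + k′ ≡ n × n ≤ 2 * k × (p ∸ 1) * k ≤ 2 * k′
    bounds (L , 1≤L , idem) = ∑ (allFin n) (κ 1≤L) , ∑ (allFin n) (λ i → 1 ∸ κ 1≤L i) , ∑κ+∑[1-κ] 1≤L ,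
      n≤2∑κ (proj₁ (q-odd L)) (proj₂ (q-odd L)) idem , [p-1]∑κ≤2∑[1-κ] 1≤L
      where open Count pr p∣1+n

-- From a generator matrix to a tiling lattice

dot-⊕ : ∀ (r k l : Vec ℤ n) → dot r (k ⊕ l) ≡ dot r k ℤ.+ dot r l
dot-⊕ [] [] [] = refl
dot-⊕ (a ∷ r) (b ∷ k) (c ∷ l) = trans (cong (ℤ._+_ (a ℤ.* (b ℤ.+ c))) (dot-⊕ r k l))
  (eq a b c (dot r k) (dot r l))
  where
  eq : ∀ a b c x y → a ℤ.* (b ℤ.+ c) ℤ.+ (x ℤ.+ y) ≡ (a ℤ.* b ℤ.+ x) ℤ.+ (a ℤ.* c ℤ.+ y)
  eq = ℤ-Solver.solve-∀

dot-• : ∀ (r : Vec ℤ n) c k → dot r (c • k) ≡ c ℤ.* dot r k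
dot-• [] c [] = sym (ℤₚ.*-zeroʳ c)
dot-• (a ∷ r) c (b ∷ k) = trans (cong (ℤ._+_ (a ℤ.* (c ℤ.* b))) (dot-• r c k)) (eq a b c (dot r k))
  where
  eq : ∀ a b c x → a ℤ.* (c ℤ.* b) ℤ.+ c ℤ.* x ≡ c ℤ.* (a ℤ.* b ℤ.+ x)
  eq = ℤ-Solver.solve-∀

·-⊕ : ∀ {m} (G : Vec (Vec ℤ n) m) (k l : Point n) →
  Vec.map (λ r → dot r (k ⊕ l)) G ≡ Vec.map (λ r → dot r k) G ⊕ Vec.map (λ r → dot r l) G
·-⊕ [] k l = refl
·-⊕ (r ∷ G) k l = cong₂ _∷_ (dot-⊕ r k l) (·-⊕ G k l)

·-• : ∀ {m} (G : Vec (Vec ℤ n) m) c (k : Point n) →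
  Vec.map (λ r → dot r (c • k)) G ≡ c • Vec.map (λ r → dot r k) G
·-• [] c k = refl
·-• (r ∷ G) c k = cong₂ _∷_ (dot-• r c k) (·-• G c k)

tilingLattice : (G : Matrix n) → IsTiling n (LatticeOf G) → TilingLattice (LatticeOf G)
tilingLattice {n} G (cover , unique) = record
  { Λ? = Λ? ; Λ-⊕ = Λ-⊕ ; Λ-• = Λ-• ; covered = covered ; disjoint = disjoint }
  where
  Λ = LatticeOf G
  Λ-⊕ : ∀ {x y} → Λ x → Λ y → Λ (x ⊕ y)
  Λ-⊕ (k , refl) (l , refl) = k ⊕ l , sym (·-⊕ G k l)
  Λ-• : ∀ c {x} → Λ x → Λ (c • x)
  Λ-• c (k , refl) = c • k , sym (·-• G c k)
  0∈Υ : Upsilon n 0ᵥ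
  0∈Υ = ∈tile⇒Upsilon (cube⊆tile (0ᵥ∈cube n))
  -- A lattice point z has the decomposition z + 0 with 0 in Υₙ. By uniqueness, z lies in Λ exactly
  -- when the covering of z returns z itself as its centre.
  Λ? : ∀ z → Dec (Λ z)
  Λ? z with cover z
  ... | x , u , x∈Λ , u∈Υ , z≡x⊕u with Vecₚ.≡-dec ℤ._≟_ z x
  ...   | yes refl = yes x∈Λ
  ...   | no z≢x   = no λ z∈Λ → z≢x (unique z x 0ᵥ u z∈Λ x∈Λ 0∈Υ u∈Υ (trans (⊕-identityʳ z) z≡x⊕u))
  -- Covering -z as x + u gives z + u = -x, which lies in Λ.
  covered : ∀ z → ∃ λ u → u ∈ tile n × Λ (z ⊕ u)
  covered z with x , u , x∈Λ , u∈Υ , e ← cover (⊖ z) = u , Upsilon⇒∈tile u∈Υ ,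
    subst Λ (sym (trans (cong (_⊕ u) (trans (sym (⊖-involutive z)) (cong ⊖_ e))) (⊖[x⊕u]⊕u x u)))
      (Λ-• -1ℤ x∈Λ)
  -- Both -(z + u) + u and -(z + v) + v equal -z, so the uniqueness of the centre identifies z + u
  -- with z + v.
  disjoint : ∀ z {u v} → u ∈ tile n → v ∈ tile n → Λ (z ⊕ u) → Λ (z ⊕ v) → u ≡ v
  disjoint z {u} {v} u∈ v∈ a b = begin
    u                        ≡⟨ x⊕y⊖y u z ⟨
    (u ⊕ z) ⊕ (⊖ z)          ≡⟨ cong (_⊕ (⊖ z)) (⊕-comm u z) ⟩
    (z ⊕ u) ⊕ (⊖ z)          ≡⟨ cong (_⊕ (⊖ z)) (⊖-injective (unique _ _ u v (Λ-• -1ℤ a) (Λ-• -1ℤ b)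
                                  (∈tile⇒Upsilon u∈) (∈tile⇒Upsilon v∈)
                                  (trans (⊖[x⊕u]⊕u z u) (sym (⊖[x⊕u]⊕u z v))))) ⟩
    (z ⊕ v) ⊕ (⊖ z)          ≡⟨ cong (_⊕ (⊖ z)) (⊕-comm z v) ⟩
    (v ⊕ z) ⊕ (⊖ z)          ≡⟨ x⊕y⊖y v z ⟩
    v ∎
    where
    open ≡-Reasoning
    ⊖-injective : ∀ {x y : Point n} → ⊖ x ≡ ⊖ y → x ≡ y
    ⊖-injective {x} {y} e = trans (sym (⊖-involutive x)) (trans (cong ⊖_ e) (⊖-involutive y))

-- The prime divisors of n + 1

parity : ∀ m → ∃ λ s → m ≡ s * 2 ⊎ m ≡ 1 + s * 2
parity zero = 0 , inj₁ refl
parity (suc m) with parity m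
... | s , inj₁ refl = s , inj₂ refl
... | s , inj₂ refl = suc s , inj₁ refl

prime-2-or-odd : ∀ {p} → Prime p → p ≡ 2 ⊎ ∃ λ s → p ≡ 1 + s * 2
prime-2-or-odd {p} pr with parity p
... | s , inj₂ e = inj₂ (s , e)
... | s , inj₁ e with prime⇒irreducible pr (divides s e)
...   | inj₂ 2≡p = inj₁ (sym 2≡p)

all≡⇒product : ∀ b L → All (_≡ b) L → product L ≡ b ^ length L
all≡⇒product b [] [] = refl
all≡⇒product b (_ ∷ L) (refl ∷ e) = cong (b *_) (all≡⇒product b L e)

-- The exponent t is the number of prime factors of m + 1; it is positive because the empty product
-- would force m = 0.
uniform-prime-factors : ∀ {m b} → 1 ≤ m → (∀ {p} → Prime p → p ∣ suc m → p ≡ b) →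
  ∃ λ t → 0 < t × m ≡ b ^ t ∸ 1
uniform-prime-factors {m} {b} 1≤m only with factorise (suc m)
... | record { factors = [] ; isFactorisation = e } = contradiction (ℕₚ.suc-injective e) (ℕₚ.>⇒≢ 1≤m)
... | record { factors = L@(_ ∷ _) ; isFactorisation = e ; factorsPrime = prs } =
  length L , s≤s z≤n , cong (_∸ 1) (trans e (all≡⇒product b L (All.tabulate λ {p} p∈L →
    only (All.lookup prs p∈L) (subst (p ∣_) (sym e) (∈⇒∣product p∈L)))))

odd-prime-divisor : ∀ {Λ : Point n → Set} → TilingLattice Λ → 1 ≤ n →
  ∀ s → Prime (1 + s * 2) → (1 + s * 2) ∣ suc n → s ≡ 1 × 2 ∣ n
odd-prime-divisor T 1≤n s pr p∣1+n = conclude (TilingLattice.odd-prime-bounds T pr p∣1+n s refl)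
  where
  conclude : (∃ λ k → ∃ λ k′ → k + k′ ≡ _ × _ ≤ 2 * k × (s * 2) * k ≤ 2 * k′) → s ≡ 1 × 2 ∣ _
  conclude (_ , _ , k+k′≡n , n≤2k , le) = bounds⇒p≡3 s pr 1≤n k+k′≡n n≤2k le

-- If 3 divides n + 1, then n is even, which excludes the prime 2, and every odd prime divisor is 3.
-- Otherwise an odd prime divisor would have to be 3, so only 2 remains.
tilingLattice-dimension : ∀ {Λ : Point n → Set} → TilingLattice Λ → 1 ≤ n →
  ∃ λ t → 0 < t × (n ≡ 2 ^ t ∸ 1 ⊎ n ≡ 3 ^ t ∸ 1)
tilingLattice-dimension {n} T 1≤n with 3 ∣? suc n
... | yes 3∣1+n = map₂ (map₂ inj₂) (uniform-prime-factors 1≤n only3)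
  where
  2∣n : 2 ∣ n
  2∣n = proj₂ (odd-prime-divisor T 1≤n 1 (from-yes (prime? 3)) 3∣1+n)
  only3 : ∀ {p} → Prime p → p ∣ suc n → p ≡ 3
  only3 pr p∣1+n with prime-2-or-odd pr
  ... | inj₂ (s , refl) = cong (λ s → 1 + s * 2) (proj₁ (odd-prime-divisor T 1≤n s pr p∣1+n))
  ... | inj₁ refl = contradiction (∣1⇒≡1 (∣m+n∣m⇒∣n (subst (2 ∣_) (ℕₚ.+-comm 1 n) p∣1+n) 2∣n)) λ ()
... | no 3∤1+n = map₂ (map₂ inj₁) (uniform-prime-factors 1≤n only2)
  where
  only2 : ∀ {p} → Prime p → p ∣ suc n → p ≡ 2
  only2 pr p∣1+n with prime-2-or-odd pr
  ... | inj₁ e = e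
  ... | inj₂ (s , refl) = contradiction
    (subst (λ s → 1 + s * 2 ∣ suc n) (proj₁ (odd-prime-divisor T 1≤n s pr p∣1+n)) p∣1+n) 3∤1+n

theorem3 : (n : ℕ) → 1 ≤ n → (G : Matrix n) → FullRank G →
    IsTiling n (LatticeOf G) →
    ∃ λ (t : ℕ) → 0 < t × (n ≡ 2 ^ t ∸ 1 ⊎ n ≡ 3 ^ t ∸ 1)
theorem3 n 1≤n G _ tiling = tilingLattice-dimension (tilingLattice G tiling) 1≤n
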